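{- Let $F$ be a monotone 3-CNF formula in which every variable occurs exactly once negated and exactly three times unnegated. Then there exists a satisfying color-structure for $F$; that is, there is a set $S$ of variables of $F$ such that (i) $S$ contains exactly one variable from each negative clause of $F$, and (ii) no positive clause of $F$ has all of its variables in $S$. (Consequently, every such formula $F$ is satisfiable.)
   Context: A 3-CNF formula is a conjunction of clauses, each a disjunction of exactly three literals. It is monotone if every clause is either positive (all literals unnegated) or negative (all literals negated). Since every variable occurs exactly once negated, the negative clauses partition the variables; the negative clause containing a variable is called its color. A color-structure for $F$ is determined by a set $S$ of variables (the "intersections", set to false; all other variables are set to true) such that every positive clause containing a variable of $S$ also contains a variable not in $S$. A satisfying color-structure is a color-structure in which $S$ contains exactly one variable of each color. -}

module Defs where

open import Data.Nat using (ℕ; _+_)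
open import Data.Fin using (Fin)
open import Data.Fin.Subset using (Subset; _∈_; _∉_)
open import Data.Product using (_×_; _,_; ∃-syntax)
open import Data.List using (List; []; _∷_; map)
open import Data.Nat.ListAction using (sum)
open import Data.List.Membership.Propositional using () renaming (_∈_ to _∈ₗ_)
open import Data.List.Relation.Unary.All using (All)
open import Relation.Binary.PropositionalEquality using (_≡_; _≢_)
open import Relation.Nullary using (Dec; yes; no)
open import Data.Fin using (_≟_)

-- A clause of a 3-CNF over variables Fin n: exactly three literals on three
-- distinct variables.  Whether the clause is positive or negative is recorded
-- by which list of the formula it belongs to.
record Clause (n : ℕ) : Set where
  constructor clause
  field
    v₁ v₂ v₃ : Fin n
    distinct₁₂ : v₁ ≢ v₂
    distinct₁₃ : v₁ ≢ v₃
    distinct₂₃ : v₂ ≢ v₃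

open Clause public

vars : ∀ {n} → Clause n → List (Fin n)
vars C = v₁ C ∷ v₂ C ∷ v₃ C ∷ []

-- A monotone 3-CNF formula over variables Fin n: a list of positive clauses
-- and a list of negative clauses (each negative clause lists the variables
-- occurring negated in it).
record Monotone3CNF (n : ℕ) : Set where
  constructor mk
  field
    positive : List (Clause n)
    negative : List (Clause n)

open Monotone3CNF public

occ1 : ∀ {n} → Fin n → Fin n → ℕ
occ1 x y with x ≟ y
... | yes _ = 1
... | no  _ = 0

occurrences : ∀ {n} → Fin n → List (Clause n) → ℕ
occurrences x cs = sum (map (λ C → occ1 x (v₁ C) + occ1 x (v₂ C) + occ1 x (v₃ C)) cs)

Occurrence-1-3 : ∀ {n} → Monotone3CNF n → Set
Occurrence-1-3 {n} F =
  (x : Fin n) → occurrences x (negative F) ≡ 1 × occurrences x (positive F) ≡ 3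

-- Color-structure with intersection set S (variables in S are set to false):
-- every positive clause containing a variable of S also contains a variable
-- not in S.
IsColorStructure : ∀ {n} → Monotone3CNF n → Subset n → Set
IsColorStructure F S =
  All (λ C → (∃[ x ] (x ∈ₗ vars C × x ∈ S)) → ∃[ y ] (y ∈ₗ vars C × y ∉ S))
      (positive F)

ExactlyOneIn : ∀ {n} → Subset n → Clause n → Set
ExactlyOneIn S C =
  ∃[ x ] (x ∈ₗ vars C × x ∈ S × (∀ y → y ∈ₗ vars C → y ∈ S → y ≡ x))

IsSatisfyingColorStructure : ∀ {n} → Monotone3CNF n → Subset n → Set
IsSatisfyingColorStructure F S =
  IsColorStructure F S × All (ExactlyOneIn S) (negative F)

module Submission where

-- The proof is a homological Hall argument over 𝔽₂.  Call a set of variables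
-- a face if it contains no positive clause, and for a set I of colours let
-- K(I) be the complex of faces using only variables with colour in I.
--
-- (1) Every cycle of K(I) on simplices with fewer than |I| vertices bounds.
-- By Meshulam's inequality, a clause e may be deleted from the complex, at the
-- price of also treating the link of e, where the connectivity needed drops by
-- (number of remaining vertices of e) − 1.  Let N be the number of live
-- variables and L the number of incidences between the remaining clauses and
-- the variables already passed to the link.  Then 6m + L ≤ 2N suffices for
-- connectivity m; initially L = 0 and N = 3|I|.  Treating an untouched clause
-- costs 6 in 2N and at most 6 in L, and lowers m by 2.  A clause with only one
-- variable left forbids that variable; dropping both costs 2 in 2N and gains 2
-- in L.  Otherwise every clause is touched once, and we have a graph.  An edge
-- with an endpoint of degree 1 costs 4 in 2N and at most 1 in L, and lowers m
-- by 1.  If no live variable has degree at most 1, then N is at most the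
-- number |E| of edges, and the bound 6m + L ≤ N + |E| takes over, which is
-- preserved by treating any edge.
--
-- (2) By (1) there are chains c(I) on simplices with |I| vertices of K(I) with
-- c(∅) the empty simplex and ∂ c(I) = Σ c(I ∖ i), summed over i ∈ I.  Split ∂
-- into the sum of its parts ∂ᵢ removing a vertex of colour i.  These commute
-- and square to zero, and they show by induction that applying all ∂ᵢ to the
-- chain of the full colour set gives the empty simplex.  So that chain
-- contains a rainbow face.

open import Defs
open import Data.Bool as Bool using (Bool; true; false; not; _∧_; _xor_)
open import Data.Bool.Properties using (xor-identityʳ; xor-same; ∧-zeroʳ; not-distribˡ-xor)
open import Data.Bool.Solver using (module xor-∧-Solver)
open import Data.Fin using (Fin; zero; suc; _≟_)
open import Data.Fin.Properties using (any?)
open import Data.Fin.Subset using (Subset; ∣_∣; ⊤; ⊥) renaming (_∈_ to _∈ₛ_; _∉_ to _∉ₛ_)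
open import Data.Fin.Subset.Properties using (∣⊥∣≡0)
open import Data.List using (List; []; _∷_; length; map; _++_)
open import Data.List.Membership.Propositional using (_∈_; find)
open import Data.List.Membership.Propositional.Properties using (∈-∃++)
open import Data.List.Relation.Binary.Permutation.Propositional using (_↭_; ↭-sym)
open import Data.List.Relation.Binary.Permutation.Propositional.Properties
  using (shift; All-resp-↭; ↭-length; map⁺)
open import Data.List.Relation.Unary.All as All using (All; []; _∷_)
open import Data.List.Relation.Unary.All.Properties using (¬All⇒Any¬; ¬Any⇒All¬)
open import Data.List.Relation.Unary.Any as Any using (here; there)
open import Data.Nat using (ℕ; zero; suc; _+_; _*_; _≤_; _<_; z≤n; s≤s; _≤?_)
open import Data.Nat.ListAction using (sum)
open import Data.Nat.ListAction.Properties using (sum-↭)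
open import Data.Nat.Properties as ℕ using (suc-injective)
open import Data.Nat.Tactic.RingSolver using (solve-∀)
open import Data.Product using (_×_; _,_; ∃-syntax; proj₁; proj₂)
open import Data.Sum using (_⊎_; inj₁; inj₂; [_,_]′)
import Data.Unit as Unit
open import Data.Vec using (Vec; []; _∷_; lookup; _[_]≔_; replicate; tabulate; zipWith)
open import Data.Vec.Properties
  using ( lookup∘update; lookup∘update′; []≔-idempotent; []≔-lookup; lookup-replicate
        ; lookup-zipWith; lookup∘tabulate; tabulate∘lookup; tabulate-cong; lookup⇒[]=; []=⇒lookup )
open import Relation.Binary.PropositionalEquality
open import Relation.Nullary using (Dec; yes; no; ¬_; contradiction)
open import Relation.Nullary.Decidable using (_×-dec_; ¬?)

open xor-∧-Solver using (_:+_; _:*_; _:=_; con) renaming (solve to xor-solve)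

private variable
  n k j m : ℕ
  E E′ : List (Clause n)

-- Chains with coefficients in 𝔽₂

Chain : ℕ → Set
Chain n = Subset n → Bool

-- Read coefficientwise: `σ` collects `f (σ ∪ v)` over the vertices `v` of `w` outside `σ`. The
-- weight `⊤` gives the full boundary, a colour class gives the part ∂ᵢ.
∂ : Subset n → Chain n → Chain n
∂ []      f []          = false
∂ (b ∷ w) f (true  ∷ σ) = ∂ w (λ τ → f (true ∷ τ)) σ
∂ (b ∷ w) f (false ∷ σ) = (b ∧ f (true ∷ σ)) xor ∂ w (λ τ → f (false ∷ τ)) σ

-- `ε v` joins `v` to the simplices without it and discards the others; `ι v` strips `v` from the
-- simplices through it and discards the others.
ε ι : Fin n → Chain n → Chain n
ε v f σ = lookup σ v ∧ f (σ [ v ]≔ false)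
ι v f σ = not (lookup σ v) ∧ f (σ [ v ]≔ true)

∂-cong : ∀ (w : Subset n) {f g} → f ≗ g → ∂ w f ≗ ∂ w g
∂-cong []      p []          = refl
∂-cong (b ∷ w) p (true  ∷ σ) = ∂-cong w (λ τ → p (true ∷ τ)) σ
∂-cong (b ∷ w) p (false ∷ σ) =
  cong₂ (λ x y → (b ∧ x) xor y) (p (true ∷ σ)) (∂-cong w (λ τ → p (false ∷ τ)) σ)

∂-zero : ∀ (w : Subset n) σ → ∂ w (λ _ → false) σ ≡ false
∂-zero []          []          = refl
∂-zero (b ∷ w)     (true  ∷ σ) = ∂-zero w σ
∂-zero (true  ∷ w) (false ∷ σ) = ∂-zero w σ
∂-zero (false ∷ w) (false ∷ σ) = ∂-zero w σ

xor-interchange : ∀ a b c d → (a xor b) xor (c xor d) ≡ (a xor c) xor (b xor d)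
xor-interchange = xor-solve 4 (λ a b c d → (a :+ b) :+ (c :+ d) := (a :+ c) :+ (b :+ d)) refl

∂-xor : ∀ (w : Subset n) f g σ → ∂ w (λ τ → f τ xor g τ) σ ≡ ∂ w f σ xor ∂ w g σ
∂-xor []      f g []          = refl
∂-xor (b ∷ w) f g (true  ∷ σ) = ∂-xor w _ _ σ
∂-xor (true ∷ w) f g (false ∷ σ)
  rewrite ∂-xor w (λ τ → f (false ∷ τ)) (λ τ → g (false ∷ τ)) σ =
  xor-interchange (f (true ∷ σ)) (g (true ∷ σ)) _ _
∂-xor (false ∷ w) f g (false ∷ σ) = ∂-xor w _ _ σ

∂-∧ : ∀ (w : Subset n) b f σ → ∂ w (λ τ → b ∧ f τ) σ ≡ b ∧ ∂ w f σ
∂-∧ w true  f σ = refl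
∂-∧ w false f σ = ∂-zero w σ

-- This additivity is what lets the full boundary be split into its parts by colour.
∂-weight-xor : ∀ (w w′ : Subset n) f σ → ∂ (zipWith _xor_ w w′) f σ ≡ ∂ w f σ xor ∂ w′ f σ
∂-weight-xor []      []        f []          = refl
∂-weight-xor (b ∷ w) (b′ ∷ w′) f (true  ∷ σ) = ∂-weight-xor w w′ _ σ
∂-weight-xor (b ∷ w) (b′ ∷ w′) f (false ∷ σ)
  rewrite ∂-weight-xor w w′ (λ τ → f (false ∷ τ)) σ =
  xor-solve 5 (λ b b′ a c d →
      (b :+ b′) :* a :+ (c :+ d) := (b :* a :+ c) :+ (b′ :* a :+ d)) refl
    b b′ (f (true ∷ σ)) _ _

∂-comm : ∀ (w w′ : Subset n) f → ∂ w (∂ w′ f) ≗ ∂ w′ (∂ w f)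
∂-comm []      []        f []          = refl
∂-comm (b ∷ w) (b′ ∷ w′) f (true  ∷ σ) = ∂-comm w w′ _ σ
∂-comm {suc n} (b ∷ w) (b′ ∷ w′) f (false ∷ σ) = begin
  (b ∧ ∂ w′ f₁ σ) xor ∂ w (λ τ → (b′ ∧ f₁ τ) xor ∂ w′ f₀ τ) σ
    ≡⟨ cong ((b ∧ ∂ w′ f₁ σ) xor_) (expand w b′ (∂ w′ f₀)) ⟩
  (b ∧ ∂ w′ f₁ σ) xor ((b′ ∧ ∂ w f₁ σ) xor ∂ w (∂ w′ f₀) σ)
    ≡⟨ cong (λ x → (b ∧ ∂ w′ f₁ σ) xor ((b′ ∧ ∂ w f₁ σ) xor x)) (∂-comm w w′ f₀ σ) ⟩
  (b ∧ ∂ w′ f₁ σ) xor ((b′ ∧ ∂ w f₁ σ) xor ∂ w′ (∂ w f₀) σ)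
    ≡⟨ xor-solve 3 (λ x y z → x :+ (y :+ z) := y :+ (x :+ z)) refl
         (b ∧ ∂ w′ f₁ σ) (b′ ∧ ∂ w f₁ σ) (∂ w′ (∂ w f₀) σ) ⟩
  (b′ ∧ ∂ w f₁ σ) xor ((b ∧ ∂ w′ f₁ σ) xor ∂ w′ (∂ w f₀) σ)
    ≡⟨ cong ((b′ ∧ ∂ w f₁ σ) xor_) (expand w′ b (∂ w f₀)) ⟨
  (b′ ∧ ∂ w f₁ σ) xor ∂ w′ (λ τ → (b ∧ f₁ τ) xor ∂ w f₀ τ) σ ∎
  where
  open ≡-Reasoning
  f₀ f₁ : Chain n
  f₀ τ = f (false ∷ τ)
  f₁ τ = f (true ∷ τ)
  expand : ∀ u c g → ∂ u (λ τ → (c ∧ f₁ τ) xor g τ) σ ≡ (c ∧ ∂ u f₁ σ) xor ∂ u g σ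
  expand u c g = trans (∂-xor u _ g σ) (cong (_xor ∂ u g σ) (∂-∧ u c f₁ σ))

-- Two vertices can be removed in two orders, and the equal results cancel over 𝔽₂.
∂-square : ∀ (w : Subset n) f σ → ∂ w (∂ w f) σ ≡ false
∂-square []      f []          = refl
∂-square (b ∷ w) f (true  ∷ σ) = ∂-square w _ σ
∂-square (b ∷ w) f (false ∷ σ)
  rewrite ∂-xor w (λ τ → b ∧ f (true ∷ τ)) (∂ w (λ τ → f (false ∷ τ))) σ
        | ∂-∧ w b (λ τ → f (true ∷ τ)) σ
        | ∂-square w (λ τ → f (false ∷ τ)) σ =
  xor-solve 1 (λ x → x :+ (x :+ con false) := con false) refl (b ∧ ∂ w (λ τ → f (true ∷ τ)) σ)

-- Some summand must be nonzero. The vertices of the rainbow set are obtained in this way.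
∂-support : ∀ (w : Subset n) f σ → ∂ w f σ ≡ true →
  ∃[ v ] (lookup w v ≡ true × lookup σ v ≡ false × f (σ [ v ]≔ true) ≡ true)
∂-support []          f []          ()
∂-support (b ∷ w)     f (true  ∷ σ) eq with ∂-support w _ σ eq
... | v , wv , σv , fv = suc v , wv , σv , fv
∂-support (false ∷ w) f (false ∷ σ) eq with ∂-support w _ σ eq
... | v , wv , σv , fv = suc v , wv , σv , fv
∂-support (true ∷ w)  f (false ∷ σ) eq with f (true ∷ σ) in fσ
... | true  = zero , refl , refl , fσ
... | false with ∂-support w _ σ eq
...   | v , wv , σv , fv = suc v , wv , σv , fv

-- ε v is the cone operator with apex v, and this is the usual cone formula.
∂-ε : ∀ (w : Subset n) v f → lookup w v ≡ true → ∀ σ → ∂ w (ε v f) σ ≡ f σ xor ε v (∂ w f) σ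
∂-ε (.true ∷ w) zero f refl (true ∷ σ) =
  xor-solve 2 (λ x y → y := x :+ (x :+ y)) refl (f (true ∷ σ)) _
∂-ε (.true ∷ w) zero f refl (false ∷ σ) rewrite ∂-zero w σ = refl
∂-ε (b ∷ w) (suc v) f wv (true  ∷ σ) = ∂-ε w v (λ τ → f (true ∷ τ)) wv σ
∂-ε (b ∷ w) (suc v) f wv (false ∷ σ)
  rewrite ∂-ε w v (λ τ → f (false ∷ τ)) wv σ =
  xor-solve 5 (λ b l x y z → b :* (l :* x) :+ (y :+ l :* z) := y :+ l :* (b :* x :+ z)) refl
    b (lookup σ v) (f (true ∷ σ [ v ]≔ false)) (f (false ∷ σ)) _

-- A simplex of `ι v f` does not contain `v`, so only other vertices are removed on either side.
-- Hence the link part of a cycle is a cycle in the link.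
∂-ι : ∀ (w : Subset n) v f σ → ∂ w (ι v f) σ ≡ ι v (∂ w f) σ
∂-ι (b ∷ w) zero f (true  ∷ σ) = ∂-zero w σ
∂-ι (true  ∷ w) zero f (false ∷ σ) = refl
∂-ι (false ∷ w) zero f (false ∷ σ) = refl
∂-ι (b ∷ w) (suc v) f (true  ∷ σ) = ∂-ι w v (λ τ → f (true ∷ τ)) σ
∂-ι (b ∷ w) (suc v) f (false ∷ σ)
  rewrite ∂-ι w v (λ τ → f (false ∷ τ)) σ =
  xor-solve 4 (λ b l x z → b :* (l :* x) :+ l :* z := l :* (b :* x :+ z)) refl
    b (not (lookup σ v)) (f (true ∷ σ [ v ]≔ true)) _

-- Links and restrictions of the independence complex

data Status : Set where
  out live picked : Status

State : ℕ → Set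
State = Vec Status

-- A picked vertex counts as present in every simplex, so that one notion of covering serves the
-- complex and all its links.
data Hit (s : State n) (σ : Subset n) (v : Fin n) : Set where
  inside : lookup σ v ≡ true → Hit s σ v
  before : lookup s v ≡ picked → Hit s σ v

Covered : State n → Subset n → List (Fin n) → Set
Covered s σ = All (Hit s σ)

-- The independence complex of the positive clauses E, restricted to the
-- non-out vertices and replaced by the link of the picked ones.
record Face (s : State n) (E : List (Clause n)) (j : ℕ) (σ : Subset n) : Set where
  constructor face
  field
    size      : ∣ σ ∣ ≡ j
    alive     : ∀ v → lookup σ v ≡ true → lookup s v ≡ live
    uncovered : All (λ C → ¬ Covered s σ (vars C)) E


open Face

_⊑_ : Chain n → (Subset n → Set) → Set
f ⊑ P = ∀ σ → f σ ≡ true → P σ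

0ᶜ : Chain n
0ᶜ _ = false

-- Vanishing reduced homology in dimension `j` - 1. For `j` = 0 the cycle may be the empty simplex,
-- and filling it takes a vertex.
Fills : State n → List (Clause n) → ℕ → Set
Fills s E j = ∀ z → z ⊑ Face s E j → ∂ ⊤ z ≗ 0ᶜ → ∃[ c ] (c ⊑ Face s E (suc j) × ∂ ⊤ c ≗ z)

Acyclic : State n → List (Clause n) → ℕ → Set
Acyclic s E m = ∀ {j} → j < m → Fills s E j

∣insert∣ : ∀ (σ : Subset n) v → lookup σ v ≡ false → ∣ σ [ v ]≔ true ∣ ≡ suc ∣ σ ∣
∣insert∣ (false ∷ σ) zero    refl = refl
∣insert∣ (false ∷ σ) (suc v) eq   = ∣insert∣ σ v eq
∣insert∣ (true  ∷ σ) (suc v) eq   = cong suc (∣insert∣ σ v eq)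

insert∘remove : ∀ (σ : Subset n) v → lookup σ v ≡ true → (σ [ v ]≔ false) [ v ]≔ true ≡ σ
insert∘remove σ v eq = trans ([]≔-idempotent σ v)
  (trans (cong (σ [ v ]≔_) (sym eq)) ([]≔-lookup σ v))

∣remove∣ : ∀ (σ : Subset n) v → lookup σ v ≡ true → ∣ σ ∣ ≡ suc ∣ σ [ v ]≔ false ∣
∣remove∣ σ v eq = trans (cong ∣_∣ (sym (insert∘remove σ v eq)))
  (∣insert∣ (σ [ v ]≔ false) v (lookup∘update v σ false))

lookup-⊤ : ∀ (v : Fin n) → lookup ⊤ v ≡ true
lookup-⊤ v = lookup-replicate v true

true≢false : true ≢ false
true≢false ()

module _ {s : State n} {v : Fin n} (sv : lookup s v ≡ live) where

  covered-insert : ∀ {σ vs} → Covered (s [ v ]≔ picked) σ vs → Covered s (σ [ v ]≔ true) vs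
  covered-insert {σ} = All.map λ {u} → go u
    where
    go : ∀ u → Hit (s [ v ]≔ picked) σ u → Hit s (σ [ v ]≔ true) u
    go u h with u ≟ v
    go u h          | yes refl = inside (lookup∘update v σ true)
    go u (inside q) | no u≢v   = inside (trans (lookup∘update′ u≢v σ true) q)
    go u (before q) | no u≢v   = before (trans (sym (lookup∘update′ u≢v s picked)) q)

  covered-remove : ∀ {σ vs} → Covered s σ vs → Covered (s [ v ]≔ picked) (σ [ v ]≔ false) vs
  covered-remove {σ} = All.map λ {u} → go u
    where
    go : ∀ u → Hit s σ u → Hit (s [ v ]≔ picked) (σ [ v ]≔ false) u
    go u h with u ≟ v
    go u h          | yes refl = before (lookup∘update v s picked)
    go u (inside q) | no u≢v   = inside (trans (lookup∘update′ u≢v σ false) q)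
    go u (before q) | no u≢v   = before (trans (lookup∘update′ u≢v s picked) q)

  face-link : ∀ {σ} → lookup σ v ≡ false →
    Face s E (suc j) (σ [ v ]≔ true) → Face (s [ v ]≔ picked) E j σ
  face-link {σ = σ} σv F = face
    (suc-injective (trans (sym (∣insert∣ σ v σv)) (size F)))
    alive′
    (All.map (λ ¬c c → ¬c (covered-insert c)) (uncovered F))
    where
    alive′ : ∀ u → lookup σ u ≡ true → lookup (s [ v ]≔ picked) u ≡ live
    alive′ u σu with u ≟ v
    ... | yes refl = contradiction (trans (sym σu) σv) true≢false
    ... | no  u≢v  = trans (lookup∘update′ u≢v s picked)
                       (alive F u (trans (lookup∘update′ u≢v σ true) σu))

  face-cone : ∀ {σ} → lookup σ v ≡ true →
    Face (s [ v ]≔ picked) E j (σ [ v ]≔ false) → Face s E (suc j) σ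
  face-cone {σ = σ} σv F = face
    (trans (∣remove∣ σ v σv) (cong suc (size F)))
    alive′
    (All.map (λ ¬c c → ¬c (covered-remove c)) (uncovered F))
    where
    alive′ : ∀ u → lookup σ u ≡ true → lookup s u ≡ live
    alive′ u σu with u ≟ v
    ... | yes refl = sv
    ... | no  u≢v  = trans (sym (lookup∘update′ u≢v s picked))
                       (alive F u (trans (lookup∘update′ u≢v σ false) σu))

  ι-⊑ : ∀ {c} → c ⊑ Face s E (suc j) → ι v c ⊑ Face (s [ v ]≔ picked) E j
  ι-⊑ c⊑ σ eq with lookup σ v in σv
  ... | false = face-link σv (c⊑ _ eq)

  ε-⊑ : ∀ {w} → w ⊑ Face (s [ v ]≔ picked) E j → ε v w ⊑ Face s E (suc j)
  ε-⊑ w⊑ σ eq with lookup σ v in σv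
  ... | true = face-cone σv (w⊑ _ eq)

  picked-avoided : ∀ {w} → w ⊑ Face (s [ v ]≔ picked) E j → ∀ σ → lookup σ v ≡ true → w σ ≡ false
  picked-avoided {w = w} w⊑ σ σv with w σ in eq
  ... | false = refl
  ... | true  with () ← trans (sym (lookup∘update v s picked)) (alive (w⊑ σ eq) v σv)

covered-⊆ : ∀ {s : State n} {σ v vs} → Covered s σ vs → Covered s (σ [ v ]≔ true) vs
covered-⊆ {s = s} {σ} {v} = All.map λ {u} → go u
  where
  go : ∀ u → Hit s σ u → Hit s (σ [ v ]≔ true) u
  go u h with u ≟ v
  go u h          | yes refl = inside (lookup∘update v σ true)
  go u (inside q) | no u≢v   = inside (trans (lookup∘update′ u≢v σ true) q)
  go u (before q) | no u≢v   = before q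

face-down : ∀ {s : State n} {σ v} → lookup σ v ≡ false → Face s E (suc j) (σ [ v ]≔ true) → Face s E j σ
face-down {s = s} {σ} {v} σv F = face
  (suc-injective (trans (sym (∣insert∣ σ v σv)) (size F)))
  alive′
  (All.map (λ ¬c c → ¬c (covered-⊆ c)) (uncovered F))
  where
  alive′ : ∀ u → lookup σ u ≡ true → lookup s u ≡ live
  alive′ u σu with u ≟ v
  ... | yes refl = contradiction (trans (sym σu) σv) true≢false
  ... | no  u≢v  = alive F u (trans (lookup∘update′ u≢v σ true) σu)

∂-⊑ : ∀ {s : State n} w {c} → c ⊑ Face s E (suc j) → ∂ w c ⊑ Face s E j
∂-⊑ w {c} c⊑ σ eq with ∂-support w c σ eq
... | v , _ , σv , cv = face-down σv (c⊑ _ cv)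

xor-⊑ : ∀ {P : Subset n → Set} {f g} → f ⊑ P → g ⊑ P → (λ σ → f σ xor g σ) ⊑ P
xor-⊑ {f = f} f⊑ g⊑ σ eq with f σ in fσ
... | true  = f⊑ σ fσ
... | false = g⊑ σ eq

0-⊑ : ∀ {P : Subset n → Set} → 0ᶜ ⊑ P
0-⊑ σ ()

vanishes : ∀ {P : Subset n → Set} {f} → f ⊑ P → ∀ σ → ¬ P σ → f σ ≡ false
vanishes {f = f} f⊑ σ ¬P with f σ in eq
... | false = refl
... | true  = contradiction (f⊑ σ eq) ¬P

-- Passing to the link of a clause

isLive isPicked : Status → ℕ
isLive live = 1
isLive _    = 0
isPicked picked = 1
isPicked _      = 0

pick : Fin n → State n → State n
pick v s with lookup s v
... | live = s [ v ]≔ picked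
... | _    = s

pickAll : List (Fin n) → State n → State n
pickAll []       s = s
pickAll (v ∷ vs) s = pickAll vs (pick v s)

-- Only vertices that newly enter the link count; each of them lowers the size of the simplices by
-- one.
picks : List (Fin n) → State n → ℕ
picks []       s = 0
picks (v ∷ vs) s = isLive (lookup s v) + picks vs (pick v s)

-- A chain whose boundary avoids the simplices containing vs is pushed off
-- them by a boundary: its vs-part is a cycle in the link of vs, and the cone
-- with apex vs over a filling does it.
push-off : ∀ vs (s : State n) {c} → c ⊑ Face s E j →
  (∀ σ → Covered s σ vs → ∂ ⊤ c σ ≡ false) →
  (∀ {i} → i + picks vs s ≡ j → Fills (pickAll vs s) E i) →
  ∃[ w ] (w ⊑ Face s E (suc j) × (∀ σ → Covered s σ vs → c σ xor ∂ ⊤ w σ ≡ false))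
push-off {j = j} [] s {c} c⊑ ∂c fill
  with fill (ℕ.+-identityʳ j) c c⊑ (λ σ → ∂c σ [])
... | w , w⊑ , ∂w = w , w⊑ , λ σ _ → trans (cong (c σ xor_) (∂w σ)) (xor-same (c σ))
push-off {j = j} (v ∷ vs) s {c} c⊑ ∂c fill with lookup s v in sv
-- No simplex of `c` covers an out vertex, so nothing has to be pushed off.
... | out = 0ᶜ , 0-⊑ , avoid
  where
  avoid : ∀ σ → Covered s σ (v ∷ vs) → c σ xor ∂ ⊤ 0ᶜ σ ≡ false
  avoid σ (before pv ∷ _) with () ← trans (sym sv) pv
  avoid σ (inside σv ∷ _) = cong₂ _xor_
    (vanishes c⊑ σ (λ F → contradiction (trans (sym sv) (alive F v σv)) (λ ()))) (∂-zero ⊤ σ)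
... | picked with push-off vs s c⊑ (λ σ cov → ∂c σ (before sv ∷ cov)) fill
...   | w , w⊑ , avoid = w , w⊑ , λ { σ (_ ∷ cov) → avoid σ cov }
-- Here `c` lives on the empty simplex, which does not contain `v`.
push-off {j = zero} (v ∷ vs) s {c} c⊑ ∂c fill | live = 0ᶜ , 0-⊑ , avoid
  where
  avoid : ∀ σ → Covered s σ (v ∷ vs) → c σ xor ∂ ⊤ 0ᶜ σ ≡ false
  avoid σ (before pv ∷ _) with () ← trans (sym sv) pv
  avoid σ (inside σv ∷ _) = cong₂ _xor_
    (vanishes c⊑ σ (λ F → ℕ.0≢1+n (trans (sym (size F)) (∣remove∣ σ v σv)))) (∂-zero ⊤ σ)
push-off {n = n} {E = E} {j = suc j} (v ∷ vs) s {c} c⊑ ∂c fill | live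
  with push-off vs (s [ v ]≔ picked) (ι-⊑ sv c⊑) ∂ιc
         (λ {i} eq → fill (trans (ℕ.+-suc i _) (cong suc eq)))
  where
  ∂ιc : ∀ σ → Covered (s [ v ]≔ picked) σ vs → ∂ ⊤ (ι v c) σ ≡ false
  ∂ιc σ cov rewrite ∂-ι ⊤ v c σ with lookup σ v
  ... | true  = refl
  ... | false = ∂c _ (inside (lookup∘update v σ true) ∷ covered-insert sv cov)
... | w , w⊑ , avoid = ε v w , ε-⊑ sv w⊑ , avoid′
  where
  avoid′ : ∀ σ → Covered s σ (v ∷ vs) → c σ xor ∂ ⊤ (ε v w) σ ≡ false
  avoid′ σ (before pv ∷ _) with () ← trans (sym sv) pv
  -- In the cone formula the term `w σ` drops out, since `w` lies in the link of `v`. As `c σ` is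
  -- the coefficient of `ι v c` at `σ⁻`, the claim becomes the recursive one at `σ⁻`.
  avoid′ σ (inside σv ∷ cov) = begin
    c σ xor ∂ ⊤ (ε v w) σ
      ≡⟨ cong (c σ xor_) (∂-ε ⊤ v w (lookup-⊤ v) σ) ⟩
    c σ xor (w σ xor ε v (∂ ⊤ w) σ)
      ≡⟨ cong₂ (λ a b → c σ xor (a xor (b ∧ ∂ ⊤ w σ⁻))) (picked-avoided sv w⊑ σ σv) σv ⟩
    c σ xor ∂ ⊤ w σ⁻
      ≡⟨ cong (_xor ∂ ⊤ w σ⁻) (trans (cong c (sym (insert∘remove σ v σv)))
           (cong (λ b → not b ∧ c (σ⁻ [ v ]≔ true)) (sym (lookup∘update v σ false)))) ⟩
    ι v c σ⁻ xor ∂ ⊤ w σ⁻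
      ≡⟨ avoid σ⁻ (covered-remove sv cov) ⟩
    false ∎
    where
    open ≡-Reasoning
    σ⁻ : Subset n
    σ⁻ = σ [ v ]≔ false

-- Fill the cycle after deleting `C`. The boundary of the filling `c` avoids the simplices covering
-- `C`, so `c` can be pushed off them by adding a boundary, which leaves `∂ ⊤ c` unchanged. As `c`
-- has simplices of size `suc j`, the link is needed only in size `suc j` minus the number of picks.
fills-∷ : ∀ {s : State n} C → Fills s E j →
  (∀ {i} → i + picks (vars C) s ≡ suc j → Fills (pickAll (vars C) s) E i) →
  Fills s (C ∷ E) j
fills-∷ {E = E} {j = j} {s = s} C fill fill-link z z⊑ ∂z
  with fill z (λ σ eq → let F = z⊑ σ eq in face (size F) (alive F) (All.tail (uncovered F))) ∂z
... | c , c⊑ , ∂c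
  with push-off (vars C) s c⊑
         (λ σ cov → trans (∂c σ) (vanishes z⊑ σ (λ F → All.head (uncovered F) cov))) fill-link
... | w , w⊑ , avoid = c′ , c′⊑ , ∂c′
  where
  c′ : Chain _
  c′ σ = c σ xor ∂ ⊤ w σ
  c′⊑ : c′ ⊑ Face s (C ∷ E) (suc j)
  c′⊑ σ eq with xor-⊑ {f = c} c⊑ (∂-⊑ ⊤ w⊑) σ eq
  ... | F = face (size F) (alive F)
              ((λ cov → true≢false (trans (sym eq) (avoid σ cov))) ∷ uncovered F)
  ∂c′ : ∂ ⊤ c′ ≗ z
  ∂c′ σ = trans (∂-xor ⊤ c (∂ ⊤ w) σ)
    (trans (cong₂ _xor_ (∂c σ) (∂-square ⊤ w σ)) (xor-identityʳ (z σ)))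

-- Meshulam's deletion–explosion inequality.
acyclic-∷ : ∀ {s : State n} C {m m′} → suc m ≤ m′ + picks (vars C) s →
  Acyclic s E m → Acyclic (pickAll (vars C) s) E m′ → Acyclic s (C ∷ E) m
acyclic-∷ {s = s} C {m} {m′} m≤ del expl {j} j<m = fills-∷ C (del j<m) λ {i} eq →
  -- From `i + picks ≡ suc j` and `suc j ≤ m < m′ + picks` follows `i < m′`.
  expl (ℕ.+-cancelʳ-< (picks (vars C) s) i m′
    (ℕ.<-≤-trans (ℕ.≤-<-trans (ℕ.≤-reflexive eq) (s≤s j<m)) m≤))

acyclic-transport : ∀ {s s′ : State n} →
  (∀ {j σ} → Face s E j σ → Face s′ E′ j σ) → (∀ {j σ} → Face s′ E′ j σ → Face s E j σ) →
  Acyclic s E m → Acyclic s′ E′ m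
acyclic-transport to from acyc j<m z z⊑ ∂z
  with acyc j<m z (λ σ eq → from (z⊑ σ eq)) ∂z
... | c , c⊑ , ∂c = c , (λ σ eq → to (c⊑ σ eq)) , ∂c

-- Adding `v` to a face completes no clause, so the complex is a cone with apex `v`, and the cone
-- over a cycle fills it.
acyclic-cone : ∀ {s : State n} v → lookup s v ≡ live →
  All (λ C → All (_≢ v) (vars C)) E → Acyclic s E m
acyclic-cone {E = E} {s = s} v sv free {j} _ z z⊑ ∂z = ε v z , ε⊑ , ∂ε
  where
  shrink : ∀ {σ vs} → All (_≢ v) vs → Covered s σ vs → Covered s (σ [ v ]≔ false) vs
  shrink {σ} v∉ cov = All.zipWith (λ where
    (u≢v , inside σu) → inside (trans (lookup∘update′ u≢v σ false) σu)
    (u≢v , before su) → before su) (v∉ , cov)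
  ε⊑ : ε v z ⊑ Face s E (suc j)
  ε⊑ σ eq with lookup σ v in σv
  ... | true = face (trans (∣remove∣ σ v σv) (cong suc (size F))) alive′
      (All.zipWith (λ (v∉ , ¬c) c → ¬c (shrink v∉ c)) (free , uncovered F))
    where
    F = z⊑ (σ [ v ]≔ false) eq
    alive′ : ∀ u → lookup σ u ≡ true → lookup s u ≡ live
    alive′ u σu with u ≟ v
    ... | yes refl = sv
    ... | no  u≢v  = alive F u (trans (lookup∘update′ u≢v σ false) σu)
  ∂ε : ∂ ⊤ (ε v z) ≗ z
  ∂ε σ = begin
    ∂ ⊤ (ε v z) σ                  ≡⟨ ∂-ε ⊤ v z (lookup-⊤ v) σ ⟩
    z σ xor ε v (∂ ⊤ z) σ          ≡⟨ cong (λ b → z σ xor (lookup σ v ∧ b)) (∂z _) ⟩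
    z σ xor (lookup σ v ∧ false)   ≡⟨ cong (z σ xor_) (∧-zeroʳ _) ⟩
    z σ xor false                  ≡⟨ xor-identityʳ _ ⟩
    z σ                            ∎
    where open ≡-Reasoning

-- The potential argument

weight : (Fin n → ℕ) → Clause n → ℕ
weight g C = g (v₁ C) + g (v₂ C) + g (v₃ C)

-- With `#picked s` this is the incidence count L; with `occ1 x` it is by definition the degree of
-- `x`.
total : (Fin n → ℕ) → List (Clause n) → ℕ
total g E = sum (map (weight g) E)

total-cong : ∀ {g h : Fin n → ℕ} → (∀ v → g v ≡ h v) → ∀ E → total g E ≡ total h E
total-cong eq []      = refl
total-cong eq (C ∷ E) = cong₂ _+_
  (cong₂ _+_ (cong₂ _+_ (eq (v₁ C)) (eq (v₂ C))) (eq (v₃ C))) (total-cong eq E)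

total-+ : ∀ (g h : Fin n → ℕ) E → total (λ v → g v + h v) E ≡ total g E + total h E
total-+ g h []      = refl
total-+ g h (C ∷ E) = trans (cong (weight (λ v → g v + h v) C +_) (total-+ g h E))
  (lemma (g (v₁ C)) (g (v₂ C)) (g (v₃ C)) (h (v₁ C)) (h (v₂ C)) (h (v₃ C)) (total g E) (total h E))
  where
  lemma : ∀ a b c a′ b′ c′ x y →
    a + a′ + (b + b′) + (c + c′) + (x + y) ≡ a + b + c + x + (a′ + b′ + c′ + y)
  lemma = solve-∀

total-const : ∀ {g : Fin n → ℕ} {k} → All (λ C → weight g C ≡ k) E → total g E ≡ length E * k
total-const []       = refl
total-const {g = g} (p ∷ ps) = cong₂ _+_ p (total-const {g = g} ps)

total-↭ : ∀ (g : Fin n → ℕ) → E ↭ E′ → total g E ≡ total g E′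
total-↭ g p = sum-↭ (map⁺ (weight g) p)

occ1-refl : ∀ (x : Fin n) → occ1 x x ≡ 1
occ1-refl x with x ≟ x
... | yes _  = refl
... | no x≢x = contradiction refl x≢x

occ1-≢ : ∀ {x y : Fin n} → y ≢ x → occ1 x y ≡ 0
occ1-≢ {x = x} {y} y≢x with x ≟ y
... | yes refl = contradiction refl y≢x
... | no _     = refl

∈⇒1≤weight : ∀ {x : Fin n} C → x ∈ vars C → 1 ≤ weight (occ1 x) C
∈⇒1≤weight {x = x} C (here refl) = begin
  1                                                      ≡⟨ occ1-refl x ⟨
  occ1 x (v₁ C)                                          ≤⟨ ℕ.m≤m+n _ _ ⟩
  occ1 x (v₁ C) + occ1 x (v₂ C)                          ≤⟨ ℕ.m≤m+n _ _ ⟩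
  weight (occ1 x) C                                      ∎
  where open ℕ.≤-Reasoning
∈⇒1≤weight {x = x} C (there (here refl)) = begin
  1                                                      ≡⟨ occ1-refl x ⟨
  occ1 x (v₂ C)                                          ≤⟨ ℕ.m≤n+m _ _ ⟩
  occ1 x (v₁ C) + occ1 x (v₂ C)                          ≤⟨ ℕ.m≤m+n _ _ ⟩
  weight (occ1 x) C                                      ∎
  where open ℕ.≤-Reasoning
∈⇒1≤weight {x = x} C (there (there (here refl))) = begin
  1                                                      ≡⟨ occ1-refl x ⟨
  occ1 x (v₃ C)                                          ≤⟨ ℕ.m≤n+m _ _ ⟩
  weight (occ1 x) C                                      ∎
  where open ℕ.≤-Reasoning

-- Counting live vertices and picked incidences

#live #picked : State n → Fin n → ℕ
#live   s v = isLive (lookup s v)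
#picked s v = isPicked (lookup s v)

lives : State n → ℕ
lives []      = 0
lives (a ∷ s) = isLive a + lives s

module _ (s : State n) (x : Fin n) (sx : lookup s x ≡ live) where

  #live-update : ∀ {y} → isLive y ≡ 0 → ∀ v → #live s v ≡ #live (s [ x ]≔ y) v + occ1 x v
  #live-update {y} y≢ v with v ≟ x
  ... | yes refl rewrite sx | lookup∘update x s y | y≢ | occ1-refl x = refl
  ... | no  v≢x  rewrite lookup∘update′ v≢x s y | occ1-≢ v≢x = sym (ℕ.+-identityʳ _)

  #picked-pick : ∀ v → #picked (s [ x ]≔ picked) v ≡ #picked s v + occ1 x v
  #picked-pick v with v ≟ x
  ... | yes refl rewrite sx | lookup∘update x s picked | occ1-refl x = refl
  ... | no  v≢x  rewrite lookup∘update′ v≢x s picked | occ1-≢ v≢x = sym (ℕ.+-identityʳ _)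

  #picked-out : ∀ v → #picked (s [ x ]≔ out) v ≡ #picked s v
  #picked-out v with v ≟ x
  ... | yes refl rewrite sx | lookup∘update x s out = refl
  ... | no  v≢x  rewrite lookup∘update′ v≢x s out = refl

lives-update : ∀ (s : State n) x {y} → isLive y ≡ 0 → lookup s x ≡ live →
  lives s ≡ suc (lives (s [ x ]≔ y))
lives-update (live ∷ s) zero    y≢ refl rewrite y≢ = refl
lives-update (a ∷ s)    (suc x) y≢ sx   =
  trans (cong (isLive a +_) (lives-update s x y≢ sx)) (ℕ.+-suc (isLive a) _)

find-live : ∀ (s : State n) → 1 ≤ lives s → ∃[ x ] lookup s x ≡ live
find-live (live   ∷ s) _ = zero , refl
find-live (out    ∷ s) p with find-live s p
... | x , sx = suc x , sx
find-live (picked ∷ s) p with find-live s p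
... | x , sx = suc x , sx

lookup-pick-other : ∀ (s : State n) {u v} → u ≢ v → lookup (pick v s) u ≡ lookup s u
lookup-pick-other s {u} {v} u≢v with lookup s v
... | live   = lookup∘update′ u≢v s picked
... | out    = refl
... | picked = refl

pick-mono : ∀ (s : State n) v u → #picked s u ≤ #picked (pick v s) u
pick-mono s v u with lookup s v in sv
... | live   = ℕ.≤-trans (ℕ.m≤m+n _ _) (ℕ.≤-reflexive (sym (#picked-pick s v sv u)))
... | out    = ℕ.≤-refl
... | picked = ℕ.≤-refl

pickAll-mono : ∀ vs (s : State n) u → #picked s u ≤ #picked (pickAll vs s) u
pickAll-mono []       s u = ℕ.≤-refl
pickAll-mono (v ∷ vs) s u = ℕ.≤-trans (pick-mono s v u) (pickAll-mono vs (pick v s) u)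

pickAll-picked : ∀ vs (s : State n) {u} → lookup (pickAll vs s) u ≡ picked →
  u ∈ vs ⊎ lookup s u ≡ picked
pickAll-picked []       s su = inj₂ su
pickAll-picked (v ∷ vs) s {u} su with u ≟ v | pickAll-picked vs (pick v s) su
... | yes refl | _       = inj₁ (here refl)
... | no  _    | inj₁ p  = inj₁ (there p)
... | no  u≢v  | inj₂ pu = inj₂ (trans (sym (lookup-pick-other s u≢v)) pu)

lives-pick : ∀ (s : State n) v → lives s ≡ #live s v + lives (pick v s)
lives-pick s v with lookup s v in sv
... | live   = lives-update s v refl sv
... | out    = refl
... | picked = refl

total-pick : ∀ (s : State n) v E →
  total (#picked (pick v s)) E ≡ total (#picked s) E + #live s v * occurrences v E
total-pick s v E with lookup s v in sv
... | live   = trans (total-cong (#picked-pick s v sv) E) (trans (total-+ (#picked s) (occ1 v) E)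
                 (cong (total (#picked s) E +_) (sym (ℕ.*-identityˡ _))))
... | out    = sym (ℕ.+-identityʳ _)
... | picked = sym (ℕ.+-identityʳ _)

module _ (s : State n) (C : Clause n) where
  private
    a = v₁ C
    b = v₂ C
    c = v₃ C
    s₁ = pick a s
    s₂ = pick b s₁

    -- The three vertices are distinct, so earlier picks do not affect later ones and all counts can
    -- be read off the initial state.
    at-b : lookup s₁ b ≡ lookup s b
    at-b = lookup-pick-other s (≢-sym (distinct₁₂ C))

    at-c : lookup s₂ c ≡ lookup s c
    at-c = trans (lookup-pick-other s₁ (≢-sym (distinct₂₃ C)))
                 (lookup-pick-other s (≢-sym (distinct₁₃ C)))

  picks-clause : picks (vars C) s ≡ weight (#live s) C
  picks-clause = trans (cong₂ (λ x y → #live s a + (x + (y + 0))) (cong isLive at-b) (cong isLive at-c))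
    (lemma (#live s a) (#live s b) (#live s c))
    where
    lemma : ∀ x y z → x + (y + (z + 0)) ≡ x + y + z
    lemma = solve-∀

  lives-clause : lives s ≡ weight (#live s) C + lives (pickAll (vars C) s)
  lives-clause = begin
    lives s
      ≡⟨ lives-pick s a ⟩
    #live s a + lives s₁
      ≡⟨ cong (#live s a +_) (lives-pick s₁ b) ⟩
    #live s a + (#live s₁ b + lives s₂)
      ≡⟨ cong (λ z → #live s a + (#live s₁ b + z)) (lives-pick s₂ c) ⟩
    #live s a + (#live s₁ b + (#live s₂ c + lives (pick c s₂)))
      ≡⟨ cong₂ (λ x y → #live s a + (x + (y + lives (pick c s₂)))) (cong isLive at-b) (cong isLive at-c) ⟩
    #live s a + (#live s b + (#live s c + lives (pick c s₂)))
      ≡⟨ lemma (#live s a) (#live s b) (#live s c) (lives (pick c s₂)) ⟩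
    weight (#live s) C + lives (pick c s₂) ∎
    where
    open ≡-Reasoning
    lemma : ∀ x y z t → x + (y + (z + t)) ≡ x + y + z + t
    lemma = solve-∀

  total-clause : ∀ E → total (#picked (pickAll (vars C) s)) E ≡
    total (#picked s) E + weight (λ v → #live s v * occurrences v E) C
  total-clause E = begin
    total (#picked (pick c s₂)) E
      ≡⟨ total-pick s₂ c E ⟩
    total (#picked s₂) E + #live s₂ c * O c
      ≡⟨ cong (_+ #live s₂ c * O c) (total-pick s₁ b E) ⟩
    total (#picked s₁) E + #live s₁ b * O b + #live s₂ c * O c
      ≡⟨ cong (λ t → t + #live s₁ b * O b + #live s₂ c * O c) (total-pick s a E) ⟩
    total (#picked s) E + #live s a * O a + #live s₁ b * O b + #live s₂ c * O c
      ≡⟨ cong₂ (λ x y → total (#picked s) E + #live s a * O a + isLive x * O b + isLive y * O c) at-b at-c ⟩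
    total (#picked s) E + #live s a * O a + #live s b * O b + #live s c * O c
      ≡⟨ lemma (total (#picked s) E) (#live s a * O a) (#live s b * O b) (#live s c * O c) ⟩
    total (#picked s) E + weight (λ v → #live s v * occurrences v E) C ∎
    where
    open ≡-Reasoning
    O = λ v → occurrences v E
    lemma : ∀ t x y z → t + x + y + z ≡ t + (x + y + z)
    lemma = solve-∀

-- Kinds of clauses and the invariant

AllPicked : State n → Clause n → Set
AllPicked s C = All (λ v → lookup s v ≡ picked) (vars C)

-- A `void` clause can never be covered, a `full` one leaves no faces, a `forced` one forbids its
-- last vertex, a `mixed` one acts as an edge, and a `free` one is untouched.
data Kind (s : State n) (C : Clause n) : Set where
  void   : ∀ {v} → v ∈ vars C → lookup s v ≡ out → Kind s C
  full   : AllPicked s C → Kind s C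
  forced : ∀ {x} → x ∈ vars C → lookup s x ≡ live →
           All (λ u → u ≡ x ⊎ lookup s u ≡ picked) (vars C) → weight (#picked s) C ≡ 2 → Kind s C
  mixed  : weight (#picked s) C ≡ 1 → weight (#live s) C ≡ 2 → Kind s C
  free   : weight (#picked s) C ≡ 0 → weight (#live s) C ≡ 3 → Kind s C

kind : ∀ (s : State n) C → Kind s C
kind s C with lookup s (v₁ C) in p | lookup s (v₂ C) in q | lookup s (v₃ C) in r
... | out    | _      | _      = void (here refl) p
... | _      | out    | _      = void (there (here refl)) q
... | _      | _      | out    = void (there (there (here refl))) r
... | picked | picked | picked = full (p ∷ q ∷ r ∷ [])
... | live   | picked | picked = forced (here refl) p (inj₁ refl ∷ inj₂ q ∷ inj₂ r ∷ [])
  (cong₂ _+_ (cong₂ _+_ (cong isPicked p) (cong isPicked q)) (cong isPicked r))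
... | picked | live   | picked = forced (there (here refl)) q (inj₂ p ∷ inj₁ refl ∷ inj₂ r ∷ [])
  (cong₂ _+_ (cong₂ _+_ (cong isPicked p) (cong isPicked q)) (cong isPicked r))
... | picked | picked | live   = forced (there (there (here refl))) r (inj₂ p ∷ inj₂ q ∷ inj₁ refl ∷ [])
  (cong₂ _+_ (cong₂ _+_ (cong isPicked p) (cong isPicked q)) (cong isPicked r))
... | picked | live   | live   = mixed
  (cong₂ _+_ (cong₂ _+_ (cong isPicked p) (cong isPicked q)) (cong isPicked r))
  (cong₂ _+_ (cong₂ _+_ (cong isLive p) (cong isLive q)) (cong isLive r))
... | live   | picked | live   = mixed
  (cong₂ _+_ (cong₂ _+_ (cong isPicked p) (cong isPicked q)) (cong isPicked r))
  (cong₂ _+_ (cong₂ _+_ (cong isLive p) (cong isLive q)) (cong isLive r))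
... | live   | live   | picked = mixed
  (cong₂ _+_ (cong₂ _+_ (cong isPicked p) (cong isPicked q)) (cong isPicked r))
  (cong₂ _+_ (cong₂ _+_ (cong isLive p) (cong isLive q)) (cong isLive r))
... | live   | live   | live   = free
  (cong₂ _+_ (cong₂ _+_ (cong isPicked p) (cong isPicked q)) (cong isPicked r))
  (cong₂ _+_ (cong₂ _+_ (cong isLive p) (cong isLive q)) (cong isLive r))

Degree≤3 : List (Clause n) → Set
Degree≤3 E = ∀ x → occurrences x E ≤ 3

-- The touch condition in `Sparse` rules out `free` clauses and makes deletion harmless: the right
-- side loses one, the left at least one. Picking more vertices preserves it.
Dense Sparse : State n → List (Clause n) → ℕ → Set
Dense  s E m = 6 * m + total (#picked s) E ≤ 2 * lives s
Sparse s E m = All (λ C → 1 ≤ weight (#picked s) C) E × 6 * m + total (#picked s) E ≤ lives s + length E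

record Good (s : State n) (E : List (Clause n)) (m : ℕ) : Set where
  constructor good
  field
    degree    : Degree≤3 E
    unpicked  : All (λ C → ¬ AllPicked s C) E
    potential : Dense s E m ⊎ Sparse s E m

open Good

-- The induction runs over the clauses; the state and the bound stay arbitrary because treating a
-- clause changes them.
Solved : List (Clause n) → Set
Solved E = ∀ s m → Good s E m → Acyclic s E m

dense-↭ : ∀ (s : State n) m → E ↭ E′ → Dense s E m → Dense s E′ m
dense-↭ s m p = subst (λ t → 6 * m + t ≤ 2 * lives s) (total-↭ (#picked s) p)

sparse-↭ : ∀ (s : State n) m → E ↭ E′ → Sparse s E m → Sparse s E′ m
sparse-↭ s m p (touch , sparse) = All-resp-↭ p touch ,
  subst₂ (λ t l → 6 * m + t ≤ lives s + l) (total-↭ (#picked s) p) (↭-length p) sparse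

good-↭ : ∀ {s : State n} → E ↭ E′ → Good s E m → Good s E′ m
good-↭ {m = m} {s} p (good d u pot) = good
  (λ x → subst (_≤ 3) (total-↭ (occ1 x) p) (d x))
  (All-resp-↭ p u)
  ([ (λ dense → inj₁ (dense-↭ s m p dense)) , (λ sparse → inj₂ (sparse-↭ s m p sparse)) ]′ pot)

acyclic-↭ : ∀ {s : State n} → E ↭ E′ → Acyclic s E m → Acyclic s E′ m
acyclic-↭ p = acyclic-transport
  (λ F → face (size F) (alive F) (All-resp-↭ p (uncovered F)))
  (λ F → face (size F) (alive F) (All-resp-↭ (↭-sym p) (uncovered F)))

extract : ∀ {C : Clause n} → C ∈ E → ∃[ E′ ] (E ↭ C ∷ E′)
extract C∈E with ∈-∃++ C∈E
... | ys , zs , refl = ys ++ zs , shift _ ys zs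

degree-tail : ∀ {C : Clause n} → Degree≤3 (C ∷ E) → Degree≤3 E
degree-tail d x = ℕ.≤-trans (ℕ.m≤n+m _ _) (d x)

degree-drop : ∀ {C : Clause n} {x k} → x ∈ vars C → occurrences x (C ∷ E) ≤ suc k → occurrences x E ≤ k
degree-drop {C = C} x∈C le = ℕ.≤-pred (ℕ.≤-trans (ℕ.+-monoˡ-≤ _ (∈⇒1≤weight C x∈C)) le)

sparse-cancel : ∀ {p t m a l} → 1 ≤ p → 6 * m + (p + t) ≤ a + suc l → 6 * m + t ≤ a + l
sparse-cancel {p} {t} {m} {a} {l} 1≤p le = ℕ.≤-pred (begin
  suc (6 * m + t)     ≡⟨ ℕ.+-suc (6 * m) t ⟨
  6 * m + (1 + t)     ≤⟨ ℕ.+-monoʳ-≤ (6 * m) (ℕ.+-monoˡ-≤ t 1≤p) ⟩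
  6 * m + (p + t)     ≤⟨ le ⟩
  a + suc l           ≡⟨ ℕ.+-suc a l ⟩
  suc (a + l)         ∎)
  where open ℕ.≤-Reasoning

good-tail : ∀ {s : State n} {C} → Good s (C ∷ E) m → Good s E m
good-tail {E = E} {m} {s} {C} (good d (_ ∷ u) pot) = good (degree-tail {E = E} {C} d) u
  ([ (λ dense → inj₁ (ℕ.≤-trans (ℕ.+-monoʳ-≤ (6 * m) (ℕ.m≤n+m _ _)) dense))
   , (λ { (t ∷ ts , sparse) → inj₂ (ts , sparse-cancel {m = m} t sparse) }) ]′ pot)

drop-redundant : ∀ {s : State n} {C} →
  (∀ {j σ} → Face s E j σ → ¬ Covered s σ (vars C)) → Acyclic s E m → Acyclic s (C ∷ E) m
drop-redundant red = acyclic-transport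
  (λ F → face (size F) (alive F) (red F ∷ uncovered F))
  (λ F → face (size F) (alive F) (All.tail (uncovered F)))

status-≟ : ∀ (a b : Status) → Dec (a ≡ b)
status-≟ out    out    = yes refl
status-≟ out    live   = no λ ()
status-≟ out    picked = no λ ()
status-≟ live   out    = no λ ()
status-≟ live   live   = yes refl
status-≟ live   picked = no λ ()
status-≟ picked out    = no λ ()
status-≟ picked live   = no λ ()
status-≟ picked picked = yes refl

allPicked? : ∀ (s : State n) C → Dec (AllPicked s C)
allPicked? s C = All.all? (λ v → status-≟ (lookup s v) picked) (vars C)

-- If picking the vertices of C completes another clause, then C is redundant;
-- the link, which would have no faces at all, is not used.
explode : ∀ {s : State n} {C} m′ → Solved E → Good s (C ∷ E) m →
  suc m ≤ m′ + weight (#live s) C →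
  m′ ≡ 0 ⊎ (Dense (pickAll (vars C) s) E m′ ⊎ Sparse (pickAll (vars C) s) E m′) →
  Acyclic s (C ∷ E) m
explode {E = E} {m} {s} {C} m′ solved g m≤ pot
  with All.all? (λ D → ¬? (allPicked? (pickAll (vars C) s) D)) E
... | yes unpicked′ = acyclic-∷ C
  (subst (λ t → suc m ≤ m′ + t) (sym (picks-clause s C)) m≤)
  (solved s m (good-tail g))
  -- Connectivity 0 demands nothing of the link.
  ([ (λ { refl () })
   , (λ pot′ → solved _ m′ (good (degree-tail {E = E} {C} (degree g)) unpicked′ pot′)) ]′ pot)
-- Some `D` in `E` consists of vertices of `C` and vertices picked before, so whatever covers `C`
-- covers `D` as well.
... | no ¬unpicked = drop-redundant red (solved s m (good-tail g))
  where
  s′ = pickAll (vars C) s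
  red : ∀ {j σ} → Face s E j σ → ¬ Covered s σ (vars C)
  red {σ = σ} F cov = ¬unpicked (All.map (λ ¬D full → ¬D (All.map hit full)) (uncovered F))
    where
    hit : ∀ {u} → lookup s′ u ≡ picked → Hit s σ u
    hit su = [ All.lookup cov , before ]′ (pickAll-picked (vars C) s su)

-- Treating one clause of each kind

solve-void : ∀ {s : State n} {C v} → Solved E → v ∈ vars C → lookup s v ≡ out →
  Good s (C ∷ E) m → Acyclic s (C ∷ E) m
solve-void {E = E} {s = s} {C} {v} solved v∈C sv g = drop-redundant red (solved s _ (good-tail g))
  where
  red : ∀ {j σ} → Face s E j σ → ¬ Covered s σ (vars C)
  red F cov with All.lookup cov v∈C
  ... | inside σv = contradiction (trans (sym sv) (alive F v σv)) λ ()
  ... | before pv = contradiction (trans (sym sv) pv) λ ()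

-- With all other vertices picked, `C` says exactly that `x` lies in no face, so marking `x` as
-- `out` replaces `C`. In `Sparse` the right side loses one for `x` and one for `C`, and the left
-- loses the two picked incidences of `C`.
solve-forced : ∀ {s : State n} {C x} → Solved E → x ∈ vars C → lookup s x ≡ live →
  All (λ u → u ≡ x ⊎ lookup s u ≡ picked) (vars C) → weight (#picked s) C ≡ 2 →
  Good s (C ∷ E) m → Acyclic s (C ∷ E) m
solve-forced {E = E} {m} {s} {C} {x} solved x∈C sx forces two (good d (_ ∷ u) pot) =
  acyclic-transport to from (solved s′ m (good
    (degree-tail {E = E} {C} d)
    (All.map (λ ¬D all-picked → ¬D (All.map picked-back all-picked)) u)
    (pot′ pot)))
  where
  s′ = s [ x ]≔ out
  picked-back : ∀ {v} → lookup s′ v ≡ picked → lookup s v ≡ picked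
  picked-back {v} p with v ≟ x
  ... | yes refl = contradiction (trans (sym (lookup∘update x s out)) p) λ ()
  ... | no  v≢x  = trans (sym (lookup∘update′ v≢x s out)) p
  picked-forth : ∀ {v} → lookup s v ≡ picked → lookup s′ v ≡ picked
  picked-forth {v} p with v ≟ x
  ... | yes refl = contradiction (trans (sym sx) p) λ ()
  ... | no  v≢x  = trans (lookup∘update′ v≢x s out) p
  hit-back : ∀ {σ v} → Hit s′ σ v → Hit s σ v
  hit-back (inside p) = inside p
  hit-back (before p) = before (picked-back p)
  hit-forth : ∀ {σ v} → Hit s σ v → Hit s′ σ v
  hit-forth (inside p) = inside p
  hit-forth (before p) = before (picked-forth p)
  to : ∀ {j σ} → Face s′ E j σ → Face s (C ∷ E) j σ
  to {σ = σ} F = face (size F) alive′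
    (¬cov ∷ All.map (λ ¬D cov → ¬D (All.map hit-forth cov)) (uncovered F))
    where
    x∉σ : lookup σ x ≢ true
    x∉σ σx = contradiction (trans (sym (alive F x σx)) (lookup∘update x s out)) λ ()
    alive′ : ∀ v → lookup σ v ≡ true → lookup s v ≡ live
    alive′ v σv with v ≟ x
    ... | yes refl = sx
    ... | no  v≢x  = trans (sym (lookup∘update′ v≢x s out)) (alive F v σv)
    ¬cov : ¬ Covered s σ (vars C)
    ¬cov cov with All.lookup cov x∈C
    ... | inside σx = x∉σ σx
    ... | before px = contradiction (trans (sym sx) px) λ ()
  from : ∀ {j σ} → Face s (C ∷ E) j σ → Face s′ E j σ
  from {σ = σ} F = face (size F) alive′
    (All.map (λ ¬D cov → ¬D (All.map hit-back cov)) (All.tail (uncovered F)))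
    where
    alive′ : ∀ v → lookup σ v ≡ true → lookup s′ v ≡ live
    alive′ v σv with v ≟ x
    ... | no  v≢x  = trans (lookup∘update′ v≢x s out) (alive F v σv)
    ... | yes refl = contradiction
      (All.map (λ { (inj₁ refl) → inside σv ; (inj₂ p) → before p }) forces) (All.head (uncovered F))
  t = total (#picked s) E
  total≡ : total (#picked s′) E ≡ t
  total≡ = total-cong (#picked-out s x sx) E
  lives≡ : lives s ≡ suc (lives s′)
  lives≡ = lives-update s x refl sx
  shuffle : ∀ m t → 2 + (6 * m + t) ≡ 6 * m + (2 + t)
  shuffle = solve-∀
  shuffle′ : ∀ a l → suc a + suc l ≡ 2 + (a + l)
  shuffle′ = solve-∀
  weight≡ : ∀ D → weight (#picked s′) D ≡ weight (#picked s) D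
  weight≡ D = cong₂ _+_ (cong₂ _+_ (#picked-out s x sx (v₁ D)) (#picked-out s x sx (v₂ D)))
                (#picked-out s x sx (v₃ D))
  open ℕ.≤-Reasoning
  pot′ : Dense s (C ∷ E) m ⊎ Sparse s (C ∷ E) m → Dense s′ E m ⊎ Sparse s′ E m
  pot′ (inj₁ dense) = inj₁ (ℕ.+-cancelˡ-≤ 2 _ _ (begin
    2 + (6 * m + total (#picked s′) E)    ≡⟨ cong (λ t → 2 + (6 * m + t)) total≡ ⟩
    2 + (6 * m + t)                       ≡⟨ shuffle m t ⟩
    6 * m + (2 + t)                       ≡⟨ cong (λ p → 6 * m + (p + t)) two ⟨
    6 * m + (weight (#picked s) C + t)    ≤⟨ dense ⟩
    2 * lives s                           ≡⟨ cong (2 *_) lives≡ ⟩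
    2 * suc (lives s′)                    ≡⟨ ℕ.*-suc 2 (lives s′) ⟩
    2 + 2 * lives s′                      ∎))
  pot′ (inj₂ (_ ∷ touch , sparse)) = inj₂
    ( All.map (λ {D} → subst (1 ≤_) (sym (weight≡ D))) touch
    , ℕ.+-cancelˡ-≤ 2 _ _ (begin
    2 + (6 * m + total (#picked s′) E)    ≡⟨ cong (λ t → 2 + (6 * m + t)) total≡ ⟩
    2 + (6 * m + t)                       ≡⟨ shuffle m t ⟩
    6 * m + (2 + t)                       ≡⟨ cong (λ p → 6 * m + (p + t)) two ⟨
    6 * m + (weight (#picked s) C + t)    ≤⟨ sparse ⟩
    lives s + suc (length E)              ≡⟨ cong (_+ suc (length E)) lives≡ ⟩
    suc (lives s′) + suc (length E)       ≡⟨ shuffle′ (lives s′) (length E) ⟩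
    2 + (lives s′ + length E)             ∎))

module _ {s : State n} {C : Clause n} {E : List (Clause n)} (d : Degree≤3 (C ∷ E)) where
  private
    O : Fin n → ℕ
    O v = occurrences v E

    gain : ℕ
    gain = weight (λ v → #live s v * O v) C

    O≤2 : ∀ {v} → v ∈ vars C → O v ≤ 2
    O≤2 {v} v∈C = degree-drop {E = E} {C} v∈C (d v)

  -- `gain` is the growth of L over `E` when `C` is exploded. A vertex of `C` has at most two
  -- occurrences left in `E`, since `C` uses up one of three.
  gain≤ : gain ≤ weight (#live s) C * 2
  gain≤ = begin
    gain ≤⟨ ℕ.+-mono-≤ (ℕ.+-mono-≤ (ℕ.*-monoʳ-≤ (#live s (v₁ C)) (O≤2 (here refl)))
                                  (ℕ.*-monoʳ-≤ (#live s (v₂ C)) (O≤2 (there (here refl)))))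
                      (ℕ.*-monoʳ-≤ (#live s (v₃ C)) (O≤2 (there (there (here refl))))) ⟩
    _    ≡⟨ lemma (#live s (v₁ C)) (#live s (v₂ C)) (#live s (v₃ C)) ⟩
    weight (#live s) C * 2 ∎
    where
    open ℕ.≤-Reasoning
    lemma : ∀ x y z → x * 2 + y * 2 + z * 2 ≡ (x + y + z) * 2
    lemma = solve-∀

  -- The pendant vertex has no occurrence left in `E`, so its share of two is saved.
  gain≤-pendant : ∀ {x} → x ∈ vars C → lookup s x ≡ live → occurrences x (C ∷ E) ≤ 1 →
    2 + gain ≤ weight (#live s) C * 2
  gain≤-pendant {x} x∈C sx Ox≤1 = go x∈C
    where
    a = #live s (v₁ C)
    b = #live s (v₂ C)
    c = #live s (v₃ C)
    Ox≡0 : O x ≡ 0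
    Ox≡0 = ℕ.n≤0⇒n≡0 (degree-drop {E = E} {C} x∈C Ox≤1)
    step : ∀ {y} → y ≡ x → 2 + #live s y * O y ≤ #live s y * 2
    step refl rewrite sx | Ox≡0 = ℕ.≤-refl
    up : ∀ {y} → y ∈ vars C → #live s y * O y ≤ #live s y * 2
    up {y} y∈C = ℕ.*-monoʳ-≤ (#live s y) (O≤2 y∈C)
    distr : ∀ x y z → x * 2 + y * 2 + z * 2 ≡ (x + y + z) * 2
    distr = solve-∀
    open ℕ.≤-Reasoning
    go : x ∈ vars C → 2 + gain ≤ weight (#live s) C * 2
    go (here refl) = ℕ.≤-trans
      (ℕ.+-mono-≤ (ℕ.+-mono-≤ (step refl) (up (there (here refl)))) (up (there (there (here refl)))))
      (ℕ.≤-reflexive (distr a b c))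
    go (there (here refl)) = begin
      2 + (a * O (v₁ C) + b * O (v₂ C) + c * O (v₃ C))    ≡⟨ lemma (a * O (v₁ C)) (b * O (v₂ C)) _ ⟩
      a * O (v₁ C) + (2 + b * O (v₂ C)) + c * O (v₃ C)
        ≤⟨ ℕ.+-mono-≤ (ℕ.+-mono-≤ (up (here refl)) (step refl)) (up (there (there (here refl)))) ⟩
      a * 2 + b * 2 + c * 2                               ≡⟨ distr a b c ⟩
      weight (#live s) C * 2                              ∎
      where
      lemma : ∀ x y z → 2 + (x + y + z) ≡ x + (2 + y) + z
      lemma = solve-∀
    go (there (there (here refl))) = begin
      2 + (a * O (v₁ C) + b * O (v₂ C) + c * O (v₃ C))    ≡⟨ lemma (a * O (v₁ C)) (b * O (v₂ C)) _ ⟩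
      a * O (v₁ C) + b * O (v₂ C) + (2 + c * O (v₃ C))
        ≤⟨ ℕ.+-mono-≤ (ℕ.+-mono-≤ (up (here refl)) (up (there (here refl)))) (step refl) ⟩
      a * 2 + b * 2 + c * 2                               ≡⟨ distr a b c ⟩
      weight (#live s) C * 2                              ∎
      where
      lemma : ∀ x y z → 2 + (x + y + z) ≡ x + y + (2 + z)
      lemma = solve-∀

-- An account of one explosion: the drop from `6 * m` to `6 * m′` and the picked incidences of `C`
-- itself pay for the growth of L and for `k`, which bounds the loss in `2 * lives s`.
dense-explode : ∀ {s : State n} {C} k m′ → Dense s (C ∷ E) m →
  6 * m′ + weight (λ v → #live s v * occurrences v E) C + k ≤ 6 * m + weight (#picked s) C →
  2 * weight (#live s) C ≤ k →
  Dense (pickAll (vars C) s) E m′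
dense-explode {E = E} {m} {s} {C} k m′ dense budget k≥ = ℕ.+-cancelʳ-≤ k _ _ (begin
  6 * m′ + total (#picked s′) E + k        ≡⟨ cong (λ t → 6 * m′ + t + k) (total-clause s C E) ⟩
  6 * m′ + (t + gain) + k                  ≡⟨ lemma (6 * m′) t gain k ⟩
  6 * m′ + gain + k + t                    ≤⟨ ℕ.+-monoˡ-≤ t budget ⟩
  6 * m + p + t                            ≡⟨ ℕ.+-assoc (6 * m) p t ⟩
  6 * m + (p + t)                          ≤⟨ dense ⟩
  2 * lives s                              ≡⟨ cong (2 *_) (lives-clause s C) ⟩
  2 * (ℓ + lives s′)                       ≡⟨ ℕ.*-distribˡ-+ 2 ℓ (lives s′) ⟩
  2 * ℓ + 2 * lives s′                     ≤⟨ ℕ.+-monoˡ-≤ (2 * lives s′) k≥ ⟩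
  k + 2 * lives s′                         ≡⟨ ℕ.+-comm k _ ⟩
  2 * lives s′ + k                         ∎)
  where
  open ℕ.≤-Reasoning
  s′ = pickAll (vars C) s
  t = total (#picked s) E
  p = weight (#picked s) C
  ℓ = weight (#live s) C
  gain = weight (λ v → #live s v * occurrences v E) C
  lemma : ∀ a t g k → a + (t + g) + k ≡ a + g + k + t
  lemma = solve-∀

solve-free : ∀ {s : State n} {C} → Solved E → weight (#picked s) C ≡ 0 → weight (#live s) C ≡ 3 →
  Good s (C ∷ E) m → Acyclic s (C ∷ E) m
solve-free {m = zero} solved p≡ ℓ≡ g ()
-- Lowering `m` by two is impossible here, but three picks exceed `suc m` = 2 even with `m′` = 0.
solve-free {m = suc zero} {C = C} solved p≡ ℓ≡ g =
  explode 0 solved g (ℕ.≤-trans (s≤s (s≤s z≤n)) (ℕ.≤-reflexive (sym ℓ≡))) (inj₁ refl)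
solve-free {E = E} {m = suc (suc m)} {s} {C} solved p≡ ℓ≡ g with potential g
... | inj₂ (touch ∷ _ , _) = contradiction (subst (1 ≤_) p≡ touch) λ ()
-- Lowering `m` by two frees 12: six for the three lost vertices and six for `gain`.
... | inj₁ dense = explode m solved g
  (ℕ.≤-reflexive (trans (ℕ.+-comm 3 m) (cong (m +_) (sym ℓ≡))))
  (inj₂ (inj₁ (dense-explode {E = E} {suc (suc m)} {s} {C} 6 m dense
    (begin
      6 * m + gain + 6              ≤⟨ ℕ.+-monoˡ-≤ 6 (ℕ.+-monoʳ-≤ (6 * m) gain≤6) ⟩
      6 * m + 6 + 6                 ≡⟨ lemma m ⟩
      6 * suc (suc m) + 0           ≡⟨ cong (6 * suc (suc m) +_) p≡ ⟨
      6 * suc (suc m) + weight (#picked s) C ∎)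
    (ℕ.≤-reflexive (cong (2 *_) ℓ≡)))))
  where
  open ℕ.≤-Reasoning
  gain = weight (λ v → #live s v * occurrences v E) C
  gain≤6 : gain ≤ 6
  gain≤6 = subst (λ ℓ → gain ≤ ℓ * 2) ℓ≡ (gain≤ {s = s} {C} {E} (degree g))
  lemma : ∀ m → 6 * m + 6 + 6 ≡ 6 * suc (suc m) + 0
  lemma = solve-∀

solve-pendant : ∀ {s : State n} {C x} → Solved E → weight (#picked s) C ≡ 1 → weight (#live s) C ≡ 2 →
  x ∈ vars C → lookup s x ≡ live → occurrences x (C ∷ E) ≤ 1 →
  Good s (C ∷ E) (suc m) → Dense s (C ∷ E) (suc m) → Acyclic s (C ∷ E) (suc m)
solve-pendant {E = E} {m = m} {s} {C} solved p≡ ℓ≡ x∈C sx Ox g dense = explode m solved g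
  (ℕ.≤-reflexive (trans (ℕ.+-comm 2 m) (cong (m +_) (sym ℓ≡))))
  -- Lowering `m` by one frees 6, and the picked vertex of `C` frees 1. The costs are 4 for two live
  -- vertices and at most 2 for `gain`, leaving one to spare.
  (inj₂ (inj₁ (dense-explode {E = E} {suc m} {s} {C} 4 m dense
    (begin
      6 * m + gain + 4               ≤⟨ ℕ.+-monoˡ-≤ 4 (ℕ.+-monoʳ-≤ (6 * m) gain≤2) ⟩
      6 * m + 2 + 4                  ≤⟨ ℕ.n≤1+n _ ⟩
      suc (6 * m + 2 + 4)            ≡⟨ lemma m ⟩
      6 * suc m + 1                  ≡⟨ cong (6 * suc m +_) p≡ ⟨
      6 * suc m + weight (#picked s) C ∎)
    (ℕ.≤-reflexive (cong (2 *_) ℓ≡)))))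
  where
  open ℕ.≤-Reasoning
  gain = weight (λ v → #live s v * occurrences v E) C
  gain≤2 : gain ≤ 2
  gain≤2 = ℕ.+-cancelˡ-≤ 2 _ _
    (subst (λ ℓ → 2 + gain ≤ ℓ * 2) ℓ≡ (gain≤-pendant {s = s} {C} {E} (degree g) x∈C sx Ox))
  lemma : ∀ m → suc (6 * m + 2 + 4) ≡ 6 * suc m + 1
  lemma = solve-∀

solve-sparse : ∀ {s : State n} {C} → Solved E → weight (#picked s) C ≡ 1 → weight (#live s) C ≡ 2 →
  Good s (C ∷ E) (suc m) → Sparse s (C ∷ E) (suc m) → Acyclic s (C ∷ E) (suc m)
solve-sparse {E = E} {m = m} {s} {C} solved p≡ ℓ≡ g (_ ∷ touch , sparse) = explode m solved g
  (ℕ.≤-reflexive (trans (ℕ.+-comm 2 m) (cong (m +_) (sym ℓ≡))))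
  -- The left side changes by at most -6 + 4 - 1 = -3; the right side loses two live vertices and
  -- one clause.
  (inj₂ (inj₂ (All.map (λ {D} 1≤ → ℕ.≤-trans 1≤ (grow D)) touch , ℕ.+-cancelˡ-≤ 3 _ _ (begin
    3 + (6 * m + total (#picked s′) E)     ≡⟨ cong (λ t → 3 + (6 * m + t)) (total-clause s C E) ⟩
    3 + (6 * m + (t + gain))               ≤⟨ ℕ.+-monoʳ-≤ 3 (ℕ.+-monoʳ-≤ (6 * m) (ℕ.+-monoʳ-≤ t gain≤4)) ⟩
    3 + (6 * m + (t + 4))                  ≡⟨ lemma m t ⟩
    6 * suc m + (1 + t)                    ≡⟨ cong (λ p → 6 * suc m + (p + t)) p≡ ⟨
    6 * suc m + (weight (#picked s) C + t) ≤⟨ sparse ⟩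
    lives s + suc (length E)               ≡⟨ cong (_+ suc (length E)) (lives-clause s C) ⟩
    weight (#live s) C + lives s′ + suc (length E) ≡⟨ cong (λ ℓ → ℓ + lives s′ + suc (length E)) ℓ≡ ⟩
    2 + lives s′ + suc (length E)          ≡⟨ lemma′ (lives s′) (length E) ⟩
    3 + (lives s′ + length E)              ∎))))
  where
  open ℕ.≤-Reasoning
  s′ = pickAll (vars C) s
  t = total (#picked s) E
  gain = weight (λ v → #live s v * occurrences v E) C
  gain≤4 : gain ≤ 4
  gain≤4 = subst (λ ℓ → gain ≤ ℓ * 2) ℓ≡ (gain≤ {s = s} {C} {E} (degree g))
  grow : ∀ D → weight (#picked s) D ≤ weight (#picked s′) D
  grow D = ℕ.+-mono-≤ (ℕ.+-mono-≤ (mono (v₁ D)) (mono (v₂ D))) (mono (v₃ D))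
    where mono = pickAll-mono (vars C) s
  lemma : ∀ m t → 3 + (6 * m + (t + 4)) ≡ 6 * suc m + (1 + t)
  lemma = solve-∀
  lemma′ : ∀ a l → 2 + a + suc l ≡ 3 + (a + l)
  lemma′ = solve-∀

-- The endgame, in which every clause is an edge

Mixed : State n → Clause n → Set
Mixed s C = weight (#picked s) C ≡ 1 × weight (#live s) C ≡ 2

mixed? : ∀ (s : State n) C → Dec (Mixed s C)
mixed? s C = (weight (#picked s) C ℕ.≟ 1) ×-dec (weight (#live s) C ℕ.≟ 2)

solve-unmixed : ∀ {s : State n} {C} → Solved E → ¬ Mixed s C → Good s (C ∷ E) m → Acyclic s (C ∷ E) m
solve-unmixed {s = s} {C} solved ¬mixed g with kind s C
... | void v∈C sv           = solve-void solved v∈C sv g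
... | full all-picked       = contradiction all-picked (All.head (unpicked g))
... | forced x∈C sx fs two  = solve-forced solved x∈C sx fs two g
... | mixed p≡ ℓ≡           = contradiction (p≡ , ℓ≡) ¬mixed
... | free p≡ ℓ≡            = solve-free solved p≡ ℓ≡ g

-- Live vertices are turned `out` one at a time; each takes its own occurrences, at least two, off
-- the total.
double-count : ∀ k (s : State n) → lives s ≡ k →
  (∀ x → lookup s x ≡ live → 2 ≤ occurrences x E) → 2 * lives s ≤ total (#live s) E
double-count zero s eq _ rewrite eq = z≤n
double-count {E = E} (suc k) s eq deg with find-live s (subst (1 ≤_) (sym eq) (s≤s z≤n))
... | x , sx = begin
  2 * lives s                                ≡⟨ cong (2 *_) (lives-update s x refl sx) ⟩
  2 * suc (lives s′)                         ≡⟨ ℕ.*-suc 2 (lives s′) ⟩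
  2 + 2 * lives s′                           ≤⟨ ℕ.+-mono-≤ (deg x sx) (double-count {E = E} k s′
    (suc-injective (trans (sym (lives-update s x refl sx)) eq)) deg′) ⟩
  occurrences x E + total (#live s′) E       ≡⟨ ℕ.+-comm (occurrences x E) _ ⟩
  total (#live s′) E + occurrences x E       ≡⟨ total-+ (#live s′) (occ1 x) E ⟨
  total (λ v → #live s′ v + occ1 x v) E      ≡⟨ total-cong (#live-update s x sx refl) E ⟨
  total (#live s) E                          ∎
  where
  open ℕ.≤-Reasoning
  s′ = s [ x ]≔ out
  deg′ : ∀ y → lookup s′ y ≡ live → 2 ≤ occurrences y E
  deg′ y s′y with y ≟ x
  ... | yes refl = contradiction (trans (sym (lookup∘update x s out)) s′y) λ ()
  ... | no  y≢x  = deg y (trans (sym (lookup∘update′ y≢x s out)) s′y)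

locate : ∀ (x : Fin n) E → All (λ C → All (_≢ x) (vars C)) E ⊎ ∃[ C ] (C ∈ E × x ∈ vars C)
locate x E with Any.any? (λ C → Any.any? (x ≟_) (vars C)) E
... | yes p = inj₂ (find p)
... | no ¬p = inj₁ (All.map (λ x∉C → All.map ≢-sym (¬Any⇒All¬ _ x∉C)) (¬Any⇒All¬ E ¬p))

-- Counting live incidences from both sides, two per edge and at least two per vertex, gives N ≤
-- |E|, whence 2N ≤ N + |E|.
dense⇒sparse : ∀ (s : State n) m → All (Mixed s) E →
  (∀ x → lookup s x ≡ live → 2 ≤ occurrences x E) → Dense s E m → Sparse s E m
dense⇒sparse {E = E} s m mix deg dense =
  All.map (λ (p≡ , _) → ℕ.≤-reflexive (sym p≡)) mix , (begin
  6 * m + total (#picked s) E   ≤⟨ dense ⟩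
  2 * lives s                   ≡⟨ cong (lives s +_) (ℕ.+-identityʳ (lives s)) ⟩
  lives s + lives s             ≤⟨ ℕ.+-monoʳ-≤ (lives s) (ℕ.*-cancelˡ-≤ 2 2*lives≤) ⟩
  lives s + length E            ∎)
  where
  open ℕ.≤-Reasoning
  2*lives≤ : 2 * lives s ≤ 2 * length E
  2*lives≤ = begin
    2 * lives s          ≤⟨ double-count {E = E} (lives s) s refl deg ⟩
    total (#live s) E    ≡⟨ total-const {g = #live s} (All.map proj₂ mix) ⟩
    length E * 2         ≡⟨ ℕ.*-comm (length E) 2 ⟩
    2 * length E         ∎

-- Mixed clauses have one picked incidence each, so L = |E| cancels in the potential and a positive
-- lower bound on N remains.
sparse⇒live : ∀ (s : State n) m → All (Mixed s) E → Sparse s E (suc m) → 1 ≤ lives s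
sparse⇒live {E = E} s m mix (_ , sparse) = ℕ.+-cancelʳ-≤ (length E) 1 (lives s) (begin
  1 + length E                      ≡⟨ cong (1 +_) (ℕ.*-identityʳ (length E)) ⟨
  1 + length E * 1                  ≡⟨ cong (1 +_) (total-const {g = #picked s} (All.map proj₁ mix)) ⟨
  1 + total (#picked s) E           ≤⟨ ℕ.+-monoˡ-≤ _ (s≤s z≤n) ⟩
  6 * suc m + total (#picked s) E   ≤⟨ sparse ⟩
  lives s + length E                ∎)
  where open ℕ.≤-Reasoning

-- Induction on the number of clauses. Clauses that are not mixed are treated first, so the graph
-- argument starts only when edges alone are left.
solve : ∀ k (E : List (Clause n)) → length E ≡ k → Solved E
solve k E len s zero    g ()
solve k E len s (suc m) g = endgame k len (All.all? (mixed? s) E)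
  where
  shorter : ∀ {C E′} → E ↭ C ∷ E′ → ∀ k → length E ≡ k → Solved E′
  shorter p zero    len with () ← trans (sym (↭-length p)) len
  shorter p (suc k) len = solve k _ (suc-injective (trans (sym (↭-length p)) len))

  endgame : ∀ k → length E ≡ k → Dec (All (Mixed s) E) → Acyclic s E (suc m)
  endgame k len (no ¬mix) with find (¬All⇒Any¬ (mixed? s) E ¬mix)
  ... | C , C∈E , ¬m with extract C∈E
  ...   | E′ , p = acyclic-↭ (↭-sym p) (solve-unmixed (shorter p k len) ¬m (good-↭ p g))
  endgame k len (yes mix) = [ dense-case , sparse-case ]′ (potential g)
    where
    sparse-case : Sparse s E (suc m) → Acyclic s E (suc m)
    sparse-case sparse with find-live s (sparse⇒live s m mix sparse)
    -- Any edge may be exploded here; searching at a live `x` yields either an edge or the apex of a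
    -- cone.
    ... | x , sx with locate x E
    ...   | inj₁ isolated = acyclic-cone x sx isolated
    ...   | inj₂ (C , C∈E , _) with extract C∈E | All.lookup mix C∈E
    ...     | E′ , p | p≡ , ℓ≡ = acyclic-↭ (↭-sym p)
      (solve-sparse {s = s} (shorter p k len) p≡ ℓ≡ (good-↭ p g) (sparse-↭ s (suc m) p sparse))

    dense-case : Dense s E (suc m) → Acyclic s E (suc m)
    -- A live vertex of degree 0 is a cone apex and one of degree 1 makes its edge cheap; if there
    -- is neither, the potential is exchanged.
    dense-case dense with any? (λ x → status-≟ (lookup s x) live ×-dec (occurrences x E ≤? 1))
    ... | no ¬pendant = sparse-case (dense⇒sparse s (suc m) mix
            (λ x sx → ℕ.≰⇒> (λ O≤1 → ¬pendant (x , sx , O≤1))) dense)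
    ... | yes (x , sx , O≤1) with locate x E
    ...   | inj₁ isolated = acyclic-cone x sx isolated
    ...   | inj₂ (C , C∈E , x∈C) with extract C∈E | All.lookup mix C∈E
    ...     | E′ , p | p≡ , ℓ≡ = acyclic-↭ (↭-sym p)
      (solve-pendant {s = s} (shorter p k len) p≡ ℓ≡ x∈C sx
        (subst (_≤ 1) (total-↭ (occ1 x) p) O≤1) (good-↭ p g) (dense-↭ s (suc m) p dense))

-- Chains indexed by sets of colours

data Facet : Subset k → Subset k → Set where
  drop : ∀ {I : Subset k} → Facet (false ∷ I) (true ∷ I)
  keep : ∀ {I J : Subset k} b → Facet J I → Facet (b ∷ J) (b ∷ I)

facet-size : ∀ {I J : Subset k} → Facet J I → ∣ I ∣ ≡ suc ∣ J ∣
facet-size drop           = refl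
facet-size (keep true F)  = cong suc (facet-size F)
facet-size (keep false F) = facet-size F

-- The sum of `F (I − i)` over the colours `i` in `I`: a boundary operator on families of chains.
facets : (Subset k → Chain n) → Subset k → Chain n
facets F []          σ = false
facets F (false ∷ I) σ = facets (λ J → F (false ∷ J)) I σ
facets F (true  ∷ I) σ = F (false ∷ I) σ xor facets (λ J → F (true ∷ J)) I σ

facets-cong : ∀ {F G : Subset k → Chain n} I → (∀ {J} → Facet J I → F J ≗ G J) → facets F I ≗ facets G I
facets-cong []          p σ = refl
facets-cong (false ∷ I) p σ = facets-cong I (λ J → p (keep false J)) σ
facets-cong (true  ∷ I) p σ = cong₂ _xor_ (p drop σ) (facets-cong I (λ J → p (keep true J)) σ)

facets-⊑ : ∀ {P : Subset n → Set} {F : Subset k → Chain n} I →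
  (∀ {J} → Facet J I → F J ⊑ P) → facets F I ⊑ P
facets-⊑ (false ∷ I) p = facets-⊑ I (λ J → p (keep false J))
facets-⊑ {F = F} (true ∷ I) p = xor-⊑ {f = F (false ∷ I)} (p drop) (facets-⊑ I (λ J → p (keep true J)))

facets-zero : ∀ (I : Subset k) (σ : Subset n) → facets (λ _ → 0ᶜ) I σ ≡ false
facets-zero []          σ = refl
facets-zero (false ∷ I) σ = facets-zero I σ
facets-zero (true  ∷ I) σ = facets-zero I σ

facets-empty : ∀ (F : Subset k → Chain n) I → ∣ I ∣ ≡ 0 → facets F I ≗ 0ᶜ
facets-empty F []          eq σ = refl
facets-empty F (false ∷ I) eq σ = facets-empty _ I eq σ

facets-xor : ∀ (F G : Subset k → Chain n) I σ →
  facets (λ J τ → F J τ xor G J τ) I σ ≡ facets F I σ xor facets G I σ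
facets-xor F G []          σ = refl
facets-xor F G (false ∷ I) σ = facets-xor _ _ I σ
facets-xor F G (true  ∷ I) σ = trans (cong ((F (false ∷ I) σ xor G (false ∷ I) σ) xor_) (facets-xor _ _ I σ))
  (xor-interchange (F (false ∷ I) σ) (G (false ∷ I) σ) _ _)

∂-facets : ∀ w (F : Subset k → Chain n) I → ∂ w (facets F I) ≗ facets (λ J → ∂ w (F J)) I
∂-facets w F []          σ = ∂-zero w σ
∂-facets w F (false ∷ I) σ = ∂-facets w _ I σ
∂-facets w F (true  ∷ I) σ = trans (∂-xor w (F (false ∷ I)) _ σ)
  (cong (∂ w (F (false ∷ I)) σ xor_) (∂-facets w _ I σ))

-- Two colours are dropped in both orders and the terms cancel. This makes the chain to be filled at
-- each new layer a cycle.
facets-square : ∀ (F : Subset k → Chain n) I → facets (facets F) I ≗ 0ᶜ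
facets-square F []          σ = refl
facets-square F (false ∷ I) σ = facets-square _ I σ
facets-square F (true  ∷ I) σ = begin
  facets F₀ I σ xor facets (λ J τ → F₀ J τ xor facets F₁ J τ) I σ
    ≡⟨ cong (facets F₀ I σ xor_) (facets-xor F₀ (facets F₁) I σ) ⟩
  facets F₀ I σ xor (facets F₀ I σ xor facets (facets F₁) I σ)
    ≡⟨ cong (λ x → facets F₀ I σ xor (facets F₀ I σ xor x)) (facets-square F₁ I σ) ⟩
  facets F₀ I σ xor (facets F₀ I σ xor false)
    ≡⟨ trans (cong (facets F₀ I σ xor_) (xor-identityʳ _)) (xor-same (facets F₀ I σ)) ⟩
  false ∎
  where
  open ≡-Reasoning
  F₀ F₁ : Subset _ → Chain _
  F₀ J = F (false ∷ J)
  F₁ J = F (true ∷ J)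

-- Colour classes as weights, and contraction by all colours

odd : ℕ → Bool
odd zero    = false
odd (suc n) = not (odd n)

odd-+ : ∀ a b → odd (a + b) ≡ odd a xor odd b
odd-+ zero    b = refl
odd-+ (suc a) b = trans (cong not (odd-+ a b)) (not-distribˡ-xor (odd a) (odd b))

vec-ext : ∀ {A : Set} {xs ys : Vec A n} → (∀ i → lookup xs i ≡ lookup ys i) → xs ≡ ys
vec-ext p = trans (sym (tabulate∘lookup _)) (trans (tabulate-cong p) (tabulate∘lookup _))

-- Taking the parity of occurrences makes the sum of the colour weights the parity of the total
-- number of occurrences, which is 1 for every variable.
colour : Clause n → Subset n
colour C = tabulate λ v → odd (weight (occ1 v) C)

colours : List (Clause n) → Subset n
colours []       = ⊥
colours (C ∷ Cs) = zipWith _xor_ (colour C) (colours Cs)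

lookup-colours : ∀ (Cs : List (Clause n)) v → lookup (colours Cs) v ≡ odd (occurrences v Cs)
lookup-colours []       v = lookup-replicate v false
lookup-colours (C ∷ Cs) v = begin
  lookup (zipWith _xor_ (colour C) (colours Cs)) v       ≡⟨ lookup-zipWith _xor_ v (colour C) (colours Cs) ⟩
  lookup (colour C) v xor lookup (colours Cs) v          ≡⟨ cong₂ _xor_ (lookup∘tabulate _ v) (lookup-colours Cs v) ⟩
  odd (weight (occ1 v) C) xor odd (occurrences v Cs)     ≡⟨ odd-+ (weight (occ1 v) C) _ ⟨
  odd (occurrences v (C ∷ Cs))                           ∎
  where open ≡-Reasoning

colours-⊤ : ∀ {Cs : List (Clause n)} → (∀ v → occurrences v Cs ≡ 1) → colours Cs ≡ ⊤
colours-⊤ {Cs = Cs} p = vec-ext λ v →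
  trans (lookup-colours Cs v) (trans (cong odd (p v)) (sym (lookup-⊤ v)))

colour⇒∈ : ∀ (C : Clause n) {v} → lookup (colour C) v ≡ true → v ∈ vars C
colour⇒∈ C {v} eq with Any.any? (v ≟_) (vars C)
... | yes v∈C = v∈C
... | no  v∉C with ¬Any⇒All¬ (vars C) v∉C
...   | a ∷ b ∷ c ∷ [] = contradiction
  (trans (sym eq) (trans (lookup∘tabulate _ v) (cong odd
    (cong₂ _+_ (cong₂ _+_ (occ1-≢ (≢-sym a)) (occ1-≢ (≢-sym b))) (occ1-≢ (≢-sym c))))))
  true≢false

∂-⊥ : ∀ (f : Chain n) → ∂ ⊥ f ≗ 0ᶜ
∂-⊥ f []          = refl
∂-⊥ f (true  ∷ σ) = ∂-⊥ _ σ
∂-⊥ f (false ∷ σ) = ∂-⊥ _ σ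

contract : List (Clause n) → Chain n → Chain n
contract []       f = f
contract (C ∷ Cs) f = contract Cs (∂ (colour C) f)

contract-cong : ∀ Cs {f g : Chain n} → f ≗ g → contract Cs f ≗ contract Cs g
contract-cong []       p = p
contract-cong (C ∷ Cs) p = contract-cong Cs (∂-cong (colour C) p)

-- Having no vertex of a colour outside `I` enters only through the vanishing of that partial
-- boundary, a form that survives further boundaries because they commute.
Avoids : ∀ (Cs : List (Clause n)) → Subset (length Cs) → Chain n → Set
Avoids []       []          f = Unit.⊤
Avoids (C ∷ Cs) (true  ∷ I) f = Avoids Cs I f
Avoids (C ∷ Cs) (false ∷ I) f = ∂ (colour C) f ≗ 0ᶜ × Avoids Cs I f

avoids-∂ : ∀ w (Cs : List (Clause n)) I {f} → Avoids Cs I f → Avoids Cs I (∂ w f)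
avoids-∂ w []       []          av = av
avoids-∂ w (C ∷ Cs) (true  ∷ I) av = avoids-∂ w Cs I av
avoids-∂ w (C ∷ Cs) (false ∷ I) {f} (z , av) =
  (λ σ → trans (∂-comm (colour C) w f σ) (trans (∂-cong w z σ) (∂-zero w σ))) , avoids-∂ w Cs I av

avoids-⊥ : ∀ (Cs : List (Clause n)) {f} → Avoids Cs ⊥ f → ∂ (colours Cs) f ≗ 0ᶜ
avoids-⊥ []       {f} av = ∂-⊥ f
avoids-⊥ (C ∷ Cs) {f} (z , av) σ =
  trans (∂-weight-xor (colour C) (colours Cs) f σ) (cong₂ _xor_ (z σ) (avoids-⊥ Cs av σ))

-- Induction on the colours: applying the partial boundary of the first colour to all chains whose
-- set contains it gives a family over the remaining colours with the same boundary law and the same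
-- chain at `⊥`.
contract-family : ∀ (Cs : List (Clause n)) (F : Subset (length Cs) → Chain n) →
  (∀ I → ∂ (colours Cs) (F I) ≗ facets F I) → (∀ I → Avoids Cs I (F I)) →
  contract Cs (F ⊤) ≗ F ⊥
contract-family []       F ∂F av σ = refl
contract-family (C ∷ Cs) F ∂F av σ =
  trans (contract-family Cs F′ ∂F′ (λ I → avoids-∂ w Cs I (av (true ∷ I))) σ) (bottom σ)
  where
  open ≡-Reasoning
  w = colour C
  W = colours Cs
  F₁ F′ : Subset (length Cs) → Chain _
  F₁ I = F (true ∷ I)
  F′ I = ∂ w (F₁ I)
  split : ∀ I τ → ∂ w (F₁ I) τ xor ∂ W (F₁ I) τ ≡ F (false ∷ I) τ xor facets F₁ I τ
  split I τ = trans (sym (∂-weight-xor w W (F₁ I) τ)) (∂F (true ∷ I) τ)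
  -- For a single colour the other partial boundaries vanish, so its own is the whole boundary.
  bottom : F′ ⊥ ≗ F ⊥
  bottom τ = begin
    ∂ w (F₁ ⊥) τ                            ≡⟨ xor-identityʳ _ ⟨
    ∂ w (F₁ ⊥) τ xor false                  ≡⟨ cong (∂ w (F₁ ⊥) τ xor_) (avoids-⊥ Cs (av (true ∷ ⊥)) τ) ⟨
    ∂ w (F₁ ⊥) τ xor ∂ W (F₁ ⊥) τ           ≡⟨ split ⊥ τ ⟩
    F ⊥ τ xor facets F₁ ⊥ τ                 ≡⟨ cong (F ⊥ τ xor_) (facets-empty F₁ ⊥ (∣⊥∣≡0 (length Cs)) τ) ⟩
    F ⊥ τ xor false                         ≡⟨ xor-identityʳ _ ⟩
    F ⊥ τ                                   ∎
  -- Apply `∂ w` to `split`: on the left the square of `∂ w` vanishes, on the right `F (false ∷ I)`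
  -- avoids the first colour.
  ∂F′ : ∀ I → ∂ W (F′ I) ≗ facets F′ I
  ∂F′ I τ = begin
    ∂ W (∂ w (F₁ I)) τ
      ≡⟨ ∂-comm W w (F₁ I) τ ⟩
    ∂ w (∂ W (F₁ I)) τ
      ≡⟨ cong (_xor ∂ w (∂ W (F₁ I)) τ) (∂-square w (F₁ I) τ) ⟨
    ∂ w (∂ w (F₁ I)) τ xor ∂ w (∂ W (F₁ I)) τ
      ≡⟨ ∂-xor w _ _ τ ⟨
    ∂ w (λ τ → ∂ w (F₁ I) τ xor ∂ W (F₁ I) τ) τ
      ≡⟨ ∂-cong w (split I) τ ⟩
    ∂ w (λ τ → F (false ∷ I) τ xor facets F₁ I τ) τ
      ≡⟨ ∂-xor w (F (false ∷ I)) (facets F₁ I) τ ⟩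
    ∂ w (F (false ∷ I)) τ xor ∂ w (facets F₁ I) τ
      ≡⟨ cong₂ _xor_ (proj₁ (av (false ∷ I)) τ) (∂-facets w F₁ I τ) ⟩
    facets F′ I τ ∎

-- Reading a rainbow set off a nonzero contraction

Simple : List (Clause n) → Set
Simple Cs = ∀ v → occurrences v Cs ≤ 1

simple-tail : ∀ {C : Clause n} {Cs} → Simple (C ∷ Cs) → Simple Cs
simple-tail p v = ℕ.≤-trans (ℕ.m≤n+m _ _) (p v)

simple-disjoint : ∀ {C : Clause n} {Cs v} → Simple (C ∷ Cs) → v ∈ vars C → ¬ 1 ≤ occurrences v Cs
simple-disjoint {C = C} {Cs} {v} p v∈C 1≤ = contradiction
  (ℕ.≤-trans (ℕ.+-mono-≤ (∈⇒1≤weight C v∈C) 1≤) (p v)) λ { (s≤s ()) }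

∈⇒1≤occurrences : ∀ {D : Clause n} {Cs v} → D ∈ Cs → v ∈ vars D → 1 ≤ occurrences v Cs
∈⇒1≤occurrences {D = D} (here refl) v∈D = ℕ.≤-trans (∈⇒1≤weight D v∈D) (ℕ.m≤m+n _ _)
∈⇒1≤occurrences (there D∈) v∈D = ℕ.≤-trans (∈⇒1≤occurrences D∈ v∈D) (ℕ.m≤n+m _ _)

-- Undoing the contraction one colour at a time, `∂-support` supplies a vertex of each colour. That
-- `τ` has only vertices with colours in `Cs` is carried along to make the vertex of the next colour
-- unique.
rainbow : ∀ (Cs : List (Clause n)) f → Simple Cs → contract Cs f ⊥ ≡ true →
  ∃[ τ ] (f τ ≡ true × All (ExactlyOneIn τ) Cs × (∀ {y} → y ∈ₛ τ → 1 ≤ occurrences y Cs))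
rainbow [] f simple eq = ⊥ , eq , [] , λ {y} y∈⊥ →
  contradiction (trans (sym ([]=⇒lookup y∈⊥)) (lookup-replicate y false)) true≢false
rainbow (C ∷ Cs) f simple eq with rainbow Cs _ (simple-tail {C = C} {Cs} simple) eq
... | τ , ∂fτ , ones , inside-Cs with ∂-support (colour C) f τ ∂fτ
...   | v , cv , v∉τ , fτ⁺ = τ⁺ , fτ⁺ , one ∷ All.tabulate others , inside-C∷Cs
  where
  τ⁺ = τ [ v ]≔ true
  v∈C : v ∈ vars C
  v∈C = colour⇒∈ C cv
  disjoint : ∀ {y} → y ∈ vars C → ¬ 1 ≤ occurrences y Cs
  disjoint = simple-disjoint {C = C} {Cs} simple
  v∈τ⁺ : v ∈ₛ τ⁺
  v∈τ⁺ = lookup⇒[]= v τ⁺ (lookup∘update v τ true)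
  grow : ∀ {y} → y ∈ₛ τ → y ∈ₛ τ⁺
  grow {y} y∈τ with y ≟ v
  ... | yes refl = v∈τ⁺
  ... | no  y≢v  = lookup⇒[]= y τ⁺ (trans (lookup∘update′ y≢v τ true) ([]=⇒lookup y∈τ))
  cases : ∀ {y} → y ∈ₛ τ⁺ → y ≡ v ⊎ y ∈ₛ τ
  cases {y} y∈τ⁺ with y ≟ v
  ... | yes y≡v = inj₁ y≡v
  ... | no  y≢v = inj₂ (lookup⇒[]= y τ (trans (sym (lookup∘update′ y≢v τ true)) ([]=⇒lookup y∈τ⁺)))
  one : ExactlyOneIn τ⁺ C
  one = v , v∈C , v∈τ⁺ , λ y y∈C y∈τ⁺ →
    [ (λ y≡v → y≡v) , (λ y∈τ → contradiction (inside-Cs y∈τ) (disjoint y∈C)) ]′ (cases y∈τ⁺)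
  others : ∀ {D} → D ∈ Cs → ExactlyOneIn τ⁺ D
  others D∈Cs with All.lookup ones D∈Cs
  ... | x , x∈D , x∈τ , unique = x , x∈D , grow x∈τ , λ y y∈D y∈τ⁺ →
    [ (λ { refl → contradiction (∈⇒1≤occurrences D∈Cs y∈D) (disjoint v∈C) }) , unique y y∈D ]′ (cases y∈τ⁺)
  inside-C∷Cs : ∀ {y} → y ∈ₛ τ⁺ → 1 ≤ occurrences y (C ∷ Cs)
  inside-C∷Cs y∈τ⁺ with cases y∈τ⁺
  ... | inj₁ refl = ℕ.≤-trans (∈⇒1≤weight C v∈C) (ℕ.m≤m+n _ _)
  ... | inj₂ y∈τ  = ℕ.≤-trans (inside-Cs y∈τ) (ℕ.m≤n+m _ _)

-- The complex restricted to a set of colours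

revive : Clause n → State n → State n
revive C s = ((s [ v₁ C ]≔ live) [ v₂ C ]≔ live) [ v₃ C ]≔ live

restrict : (Cs : List (Clause n)) → Subset (length Cs) → State n
restrict []       []          = replicate _ out
restrict (C ∷ Cs) (false ∷ I) = restrict Cs I
restrict (C ∷ Cs) (true  ∷ I) = revive C (restrict Cs I)

data Revived (C : Clause n) (s : State n) (v : Fin n) : Set where
  new : v ∈ vars C → lookup (revive C s) v ≡ live → Revived C s v
  old : ¬ v ∈ vars C → lookup (revive C s) v ≡ lookup s v → Revived C s v

revived : ∀ (C : Clause n) s v → Revived C s v
revived {n} C s v = go
  where
  s₁ s₂ : State n
  s₁ = s [ v₁ C ]≔ live
  s₂ = s₁ [ v₂ C ]≔ live
  go : Revived C s v
  go with v ≟ v₃ C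
  ... | yes refl = new (there (there (here refl))) (lookup∘update v s₂ live)
  ... | no  v≢c with v ≟ v₂ C
  ...   | yes refl = new (there (here refl))
            (trans (lookup∘update′ v≢c s₂ live) (lookup∘update v s₁ live))
  ...   | no  v≢b with v ≟ v₁ C
  ...     | yes refl = new (here refl) (trans (lookup∘update′ v≢c s₂ live)
              (trans (lookup∘update′ v≢b s₁ live) (lookup∘update v s live)))
  ...     | no  v≢a = old
              (λ { (here p) → v≢a p ; (there (here p)) → v≢b p ; (there (there (here p))) → v≢c p })
              (trans (lookup∘update′ v≢c s₂ live)
                (trans (lookup∘update′ v≢b s₁ live) (lookup∘update′ v≢a s live)))

restrict-unpicked : ∀ (Cs : List (Clause n)) I v → lookup (restrict Cs I) v ≢ picked
restrict-unpicked []       []          v p = contradiction (trans (sym (lookup-replicate v out)) p) λ ()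
restrict-unpicked (C ∷ Cs) (false ∷ I) v p = restrict-unpicked Cs I v p
restrict-unpicked (C ∷ Cs) (true  ∷ I) v p with revived C (restrict Cs I) v
... | new _ q = contradiction (trans (sym q) p) λ ()
... | old _ q = restrict-unpicked Cs I v (trans (sym q) p)

restrict-occurs : ∀ (Cs : List (Clause n)) I {v} → lookup (restrict Cs I) v ≡ live → 1 ≤ occurrences v Cs
restrict-occurs []       []          {v} p = contradiction (trans (sym (lookup-replicate v out)) p) λ ()
restrict-occurs (C ∷ Cs) (false ∷ I) p = ℕ.≤-trans (restrict-occurs Cs I p) (ℕ.m≤n+m _ _)
restrict-occurs (C ∷ Cs) (true  ∷ I) {v} p with revived C (restrict Cs I) v
... | new v∈C _ = ℕ.≤-trans (∈⇒1≤weight C v∈C) (ℕ.m≤m+n _ _)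
... | old _ q   = ℕ.≤-trans (restrict-occurs Cs I (trans (sym q) p)) (ℕ.m≤n+m _ _)

restrict-facet : ∀ (Cs : List (Clause n)) {I J} → Facet J I → ∀ v →
  lookup (restrict Cs J) v ≡ live → lookup (restrict Cs I) v ≡ live
restrict-facet (C ∷ Cs) (drop {I = I}) v p with revived C (restrict Cs I) v
... | new _ q = q
... | old _ q = trans q p
restrict-facet (C ∷ Cs) (keep false F) v p = restrict-facet Cs F v p
restrict-facet (C ∷ Cs) (keep {I = I} {J} true F) v p
  with revived C (restrict Cs I) v | revived C (restrict Cs J) v
... | new _ q   | _         = q
... | old v∉C _ | new v∈C _ = contradiction v∈C v∉C
... | old _ q   | old _ q′  = trans q (restrict-facet Cs F v (trans (sym q′) p))

-- The alternative `occurrences v Cs ≡ 0` serves the induction: once the clause of a vertex has been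
-- passed, no remaining colour contains it.
restrict-avoids : ∀ (Cs : List (Clause n)) I {f} → Simple Cs →
  (∀ σ v → f σ ≡ true → lookup σ v ≡ true → lookup (restrict Cs I) v ≡ live ⊎ occurrences v Cs ≡ 0) →
  Avoids Cs I f
restrict-avoids []       []          simple sup = Unit.tt
restrict-avoids (C ∷ Cs) (true  ∷ I) simple sup =
  restrict-avoids Cs I (simple-tail {C = C} {Cs} simple) λ σ v fσ v∈σ → go v (sup σ v fσ v∈σ)
  where
  go : ∀ v → lookup (restrict (C ∷ Cs) (true ∷ I)) v ≡ live ⊎ occurrences v (C ∷ Cs) ≡ 0 →
    lookup (restrict Cs I) v ≡ live ⊎ occurrences v Cs ≡ 0
  go v (inj₂ p) = inj₂ (ℕ.m+n≡0⇒n≡0 (weight (occ1 v) C) p)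
  go v (inj₁ p) with revived C (restrict Cs I) v
  ... | new v∈C _ = inj₂ (ℕ.n<1⇒n≡0 (ℕ.≰⇒> (simple-disjoint {C = C} {Cs} simple v∈C)))
  ... | old _ q   = inj₁ (trans (sym q) p)
restrict-avoids (C ∷ Cs) (false ∷ I) {f} simple sup = zero-boundary ,
  restrict-avoids Cs I (simple-tail {C = C} {Cs} simple) λ σ v fσ v∈σ →
    [ inj₁ , (λ p → inj₂ (ℕ.m+n≡0⇒n≡0 (weight (occ1 v) C) p)) ]′ (sup σ v fσ v∈σ)
  where
  zero-boundary : ∂ (colour C) f ≗ 0ᶜ
  zero-boundary σ with ∂ (colour C) f σ in eq
  ... | false = refl
  ... | true with ∂-support (colour C) f σ eq
  ...   | v , cv , _ , fσ⁺ with sup (σ [ v ]≔ true) v fσ⁺ (lookup∘update v σ true)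
  ...     | inj₁ p = contradiction (restrict-occurs Cs I p) (simple-disjoint {C = C} {Cs} simple (colour⇒∈ C cv))
  ...     | inj₂ p = contradiction
    (subst (1 ≤_) (ℕ.m+n≡0⇒m≡0 (weight (occ1 v) C) p) (∈⇒1≤weight C (colour⇒∈ C cv))) λ ()

lives-revive-one : ∀ (s : State n) v → lookup s v ≡ out → lives (s [ v ]≔ live) ≡ suc (lives s)
lives-revive-one (out ∷ s) zero    refl = refl
lives-revive-one (a ∷ s)   (suc v) p    =
  trans (cong (isLive a +_) (lives-revive-one s v p)) (ℕ.+-suc (isLive a) _)

lives-restrict : ∀ (Cs : List (Clause n)) I → Simple Cs → lives (restrict Cs I) ≡ 3 * ∣ I ∣
lives-restrict {n} [] [] simple = none n
  where
  none : ∀ n → lives (replicate n out) ≡ 0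
  none zero    = refl
  none (suc n) = none n
lives-restrict (C ∷ Cs) (false ∷ I) simple = lives-restrict Cs I (simple-tail {C = C} {Cs} simple)
lives-restrict (C ∷ Cs) (true  ∷ I) simple = begin
  lives (revive C s)            ≡⟨ lives-revive-one s₂ (v₃ C)
    (trans (lookup∘update′ (≢-sym (distinct₂₃ C)) s₁ live)
      (trans (lookup∘update′ (≢-sym (distinct₁₃ C)) s live) (dead (there (there (here refl)))))) ⟩
  1 + lives s₂                  ≡⟨ cong suc (lives-revive-one s₁ (v₂ C)
    (trans (lookup∘update′ (≢-sym (distinct₁₂ C)) s live) (dead (there (here refl))))) ⟩
  2 + lives s₁                  ≡⟨ cong (2 +_) (lives-revive-one s (v₁ C) (dead (here refl))) ⟩
  3 + lives s                   ≡⟨ cong (3 +_) (lives-restrict Cs I (simple-tail {C = C} {Cs} simple)) ⟩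
  3 + 3 * ∣ I ∣                 ≡⟨ ℕ.*-suc 3 ∣ I ∣ ⟨
  3 * suc ∣ I ∣                 ∎
  where
  open ≡-Reasoning
  s s₁ s₂ : State _
  s = restrict Cs I
  s₁ = s [ v₁ C ]≔ live
  s₂ = s₁ [ v₂ C ]≔ live
  -- Colours are disjoint, so the vertices of `C` are not yet live and all three are newly counted.
  dead : ∀ {v} → v ∈ vars C → lookup s v ≡ out
  dead {v} v∈C with lookup s v in eq
  ... | out    = refl
  ... | live   = contradiction (restrict-occurs Cs I eq) (simple-disjoint {C = C} {Cs} simple v∈C)
  ... | picked = contradiction eq (restrict-unpicked Cs I v)

-- The chains c(I) and the conclusion

point : Chain n
point []          = true
point (true  ∷ σ) = false
point (false ∷ σ) = point σ

point-⊥ : ∀ n → point (⊥ {n}) ≡ true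
point-⊥ zero    = refl
point-⊥ (suc n) = point-⊥ n

point-size : ∀ (σ : Subset n) → point σ ≡ true → ∣ σ ∣ ≡ 0
point-size []          p = refl
point-size (false ∷ σ) p = point-size σ p

point-∉ : ∀ (σ : Subset n) → point σ ≡ true → ∀ v → lookup σ v ≡ false
point-∉ (false ∷ σ) p zero    = refl
point-∉ (false ∷ σ) p (suc v) = point-∉ σ p v

∂-point : ∂ {n} ⊤ point ≗ 0ᶜ
∂-point σ with ∂ ⊤ point σ in eq
... | false = refl
... | true with ∂-support ⊤ point σ eq
...   | v , _ , _ , p =
  trans (sym (lookup∘update v σ true)) (point-∉ (σ [ v ]≔ true) p v)

module _ (F : Monotone3CNF n) (occ : Occurrence-1-3 F) where
  private
    P N : List (Clause n)
    P = positive F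
    N = negative F

    simple : Simple N
    simple v = ℕ.≤-reflexive (proj₁ (occ v))

  -- Nothing is picked and every colour brings three live vertices, so `Dense` holds with equality.
  restrict-good : ∀ I → Good (restrict N I) P ∣ I ∣
  restrict-good I = good
    (λ x → ℕ.≤-reflexive (proj₂ (occ x)))
    (All.tabulate λ { _ (p ∷ _) → restrict-unpicked N I _ p })
    (inj₁ (ℕ.≤-reflexive (begin
      6 * ∣ I ∣ + total (#picked s) P        ≡⟨ cong (6 * ∣ I ∣ +_) (trans (total-cong none P)
        (total-const {g = λ _ → 0} {0} (All.tabulate {xs = P} λ _ → refl))) ⟩
      6 * ∣ I ∣ + length P * 0               ≡⟨ cong (6 * ∣ I ∣ +_) (ℕ.*-zeroʳ (length P)) ⟩
      6 * ∣ I ∣ + 0                          ≡⟨ ℕ.+-identityʳ _ ⟩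
      6 * ∣ I ∣                              ≡⟨ ℕ.*-assoc 2 3 ∣ I ∣ ⟩
      2 * (3 * ∣ I ∣)                        ≡⟨ cong (2 *_) (lives-restrict N I simple) ⟨
      2 * lives s                            ∎)))
    where
    open ≡-Reasoning
    s = restrict N I
    none : ∀ v → #picked s v ≡ 0
    none v with lookup s v in eq
    ... | out    = refl
    ... | live   = refl
    ... | picked = contradiction eq (restrict-unpicked N I v)

  -- The chains for the sets of exactly `j` colours; `cycle` is what filling at size `suc j`
  -- requires.
  record Layer (j : ℕ) : Set where
    field
      chain     : Subset (length N) → Chain n
      supported : ∀ I → ∣ I ∣ ≡ j → chain I ⊑ Face (restrict N I) P j
      cycle     : ∀ I → ∣ I ∣ ≡ suc j → ∂ ⊤ (facets chain I) ≗ 0ᶜ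

  open Layer

  facets-supported : ∀ (L : Layer j) I → ∣ I ∣ ≡ suc j → facets (chain L) I ⊑ Face (restrict N I) P j
  facets-supported {j} L I eq = facets-⊑ I λ {J} facet σ fσ →
    let G = supported L J (suc-injective (trans (sym (facet-size facet)) eq)) σ fσ in
    face (size G) (λ v v∈σ → restrict-facet N facet v (alive G v v∈σ))
      (All.map (λ ¬D cov → ¬D (All.map (hit {J} {I} {σ}) cov)) (uncovered G))
    where
    hit : ∀ {J I σ v} → Hit (restrict N I) σ v → Hit (restrict N J) σ v
    hit (inside p) = inside p
    hit {I = I} (before p) = contradiction p (restrict-unpicked N I _)

  fill : ∀ (L : Layer j) I → ∣ I ∣ ≡ suc j →
    ∃[ c ] (c ⊑ Face (restrict N I) P (suc j) × ∂ ⊤ c ≗ facets (chain L) I)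
  -- Acyclicity below `∣ I ∣` just reaches cycles on simplices with `j` = `∣ I ∣` - 1 vertices.
  fill {j} L I eq = solve (length P) P refl (restrict N I) ∣ I ∣ (restrict-good I)
    (ℕ.≤-reflexive (sym eq)) (facets (chain L) I) (facets-supported L I eq) (cycle L I eq)

  fillings : Layer j → Subset (length N) → Chain n
  fillings {j} L I with ∣ I ∣ ℕ.≟ suc j
  ... | yes eq = proj₁ (fill L I eq)
  ... | no  _  = 0ᶜ

  fillings-supported : ∀ (L : Layer j) I → ∣ I ∣ ≡ suc j → fillings L I ⊑ Face (restrict N I) P (suc j)
  fillings-supported {j} L I eq with ∣ I ∣ ℕ.≟ suc j
  ... | yes eq′ = proj₁ (proj₂ (fill L I eq′))
  ... | no  neq = contradiction eq neq

  ∂-fillings : ∀ (L : Layer j) I → ∣ I ∣ ≡ suc j → ∂ ⊤ (fillings L I) ≗ facets (chain L) I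
  ∂-fillings {j} L I eq with ∣ I ∣ ℕ.≟ suc j
  ... | yes eq′ = proj₂ (proj₂ (fill L I eq′))
  ... | no  neq = contradiction eq neq

  next : Layer j → Layer (suc j)
  next L .chain     = fillings L
  next L .supported = fillings-supported L
  next L .cycle I eq σ = begin
    ∂ ⊤ (facets (fillings L) I) σ               ≡⟨ ∂-facets ⊤ (fillings L) I σ ⟩
    facets (λ J → ∂ ⊤ (fillings L J)) I σ       ≡⟨ facets-cong I (λ {J} facet →
      ∂-fillings L J (suc-injective (trans (sym (facet-size facet)) eq))) σ ⟩
    facets (facets (chain L)) I σ               ≡⟨ facets-square (chain L) I σ ⟩
    false                                       ∎
    where open ≡-Reasoning

  base : Layer 0
  base .chain _ = point
  base .supported I _ σ p = face (point-size σ p)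
    (λ v v∈σ → contradiction (trans (sym v∈σ) (point-∉ σ p v)) true≢false)
    (All.tabulate λ where
      _ (inside v∈σ ∷ _) → contradiction (trans (sym v∈σ) (point-∉ σ p _)) true≢false
      _ (before q ∷ _)   → restrict-unpicked N I _ q)
  base .cycle I _ σ = trans (∂-facets ⊤ (λ _ → point) I σ)
    (trans (facets-cong I (λ _ → ∂-point) σ) (facets-zero I σ))

  layer : ∀ j → Layer j
  layer zero    = base
  layer (suc j) = next (layer j)

  family : Subset (length N) → Chain n
  family I = chain (layer ∣ I ∣) I

  ∂-family : ∀ I → ∂ ⊤ (family I) ≗ facets family I
  ∂-family I = go ∣ I ∣ refl
    where
    go : ∀ j → ∣ I ∣ ≡ j → ∂ ⊤ (chain (layer j) I) ≗ facets family I
    go zero    eq σ = trans (∂-point σ) (sym (facets-empty family I eq σ))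
    go (suc j) eq σ = trans (∂-fillings (layer j) I eq σ) (facets-cong I (λ {J} facet τ →
      -- `family` takes each chain from the layer of its own size, and a facet of `I` has size `j`.
      cong (λ i → chain (layer i) J τ) (suc-injective (trans (sym eq) (facet-size facet)))) σ)

  rainbow-face : ∃[ S ] IsSatisfyingColorStructure F S
  rainbow-face with rainbow N (family ⊤) simple
    (trans (contract-family N family
             (λ I σ → trans (cong (λ w → ∂ w (family I) σ) (colours-⊤ {Cs = N} (λ v → proj₁ (occ v))))
                            (∂-family I σ))
             (λ I → restrict-avoids N I simple λ σ v fσ v∈σ →
                inj₁ (alive (supported (layer ∣ I ∣) I refl σ fσ) v v∈σ)) ⊥)
           (bottom ∣ ⊥ {length N} ∣ (∣⊥∣≡0 (length N))))
    where
    -- The size of `⊥` does not compute to 0 for a variable length, so it is generalised to `j`.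
    bottom : ∀ j → j ≡ 0 → chain (layer j) ⊥ ⊥ ≡ true
    bottom zero refl = point-⊥ n
  ... | S , familyS , ones , _ = S , All.map (λ {C} ¬cov _ → escape {C} ¬cov) (uncovered G) , ones
    where
    G = supported (layer ∣ ⊤ {length N} ∣) ⊤ refl S familyS
    -- A clause inside `S` would be covered, so an uncovered one has a vertex outside `S`.
    escape : ∀ {C} → ¬ Covered (restrict N ⊤) S (vars C) → ∃[ y ] (y ∈ vars C × y ∉ₛ S)
    escape {C} ¬cov with find (¬All⇒Any¬ (λ y → lookup S y Bool.≟ true) (vars C)
                                (λ all → ¬cov (All.map inside all)))
    ... | y , y∈C , y∉S = y , y∈C , λ y∈S → y∉S ([]=⇒lookup y∈S)

theorem1 : (n : ℕ) (F : Monotone3CNF n) → Occurrence-1-3 F →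
    ∃[ S ] IsSatisfyingColorStructure F S
theorem1 n F occ = rainbow-face F occ
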